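{- For every constant $\varepsilon \in (0, 1]$, there exists a semi-streaming $(3+\varepsilon)$-approximation algorithm for maximizing a non-negative submodular function subject to a cardinality constraint. The algorithm stores at most $O(k\varepsilon^{ -2}\log k)$ elements.
   Context: Problem: given a finite ground set $N$, a non-negative submodular function $f\colon 2^N\to\mathbb{R}_{\ge 0}$ (accessed through a value oracle returning $f(S)$ for any $S\subseteq N$) and a positive integer $k$, find $S\subseteq N$ with $|S|\le k$ maximizing $f(S)$. Let $OPT$ denote an optimal solution. A (possibly randomized) algorithm is a $\beta$-approximation if its output $S$ is always feasible and satisfies $\mathbb{E}[f(S)]\ge f(OPT)/\beta$. In the data stream model the elements of $N$ arrive one at a time in an arbitrary order, and the algorithm processes them in a single pass; a semi-streaming algorithm is a data stream algorithm whose memory is $O(k\cdot \mathrm{polylog}(k,|N|))$. (No bound on running time is claimed.) -}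

module Defs where

open import Level using (Level; _⊔_) renaming (suc to lsuc)
open import Algebra.Bundles using (CommutativeRing)
import Algebra.Properties.Semiring.Mult as SemiringMult
open import Data.Bool.Base using (Bool; true; false; if_then_else_)
open import Data.Fin.Base using (Fin)
open import Data.Fin.Subset using (Subset; ⊥; ⁅_⁆; _∪_; _∩_; ∣_∣)
open import Data.List.Base as List using (List; []; _∷_; allFin)
open import Data.List.Relation.Binary.Permutation.Propositional using (_↭_)
open import Data.Nat.Base as ℕ using (ℕ; suc)
open import Data.Nat.Logarithm using (⌈log₂_⌉)
open import Data.Product.Base using (∃-syntax; _×_)
open import Data.Vec.Base as Vec using (Vec; []; _∷_; lookup)
open import Function.Definitions using (Injective)
open import Relation.Binary.Construct.Closure.ReflexiveTransitive using (Star)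
open import Relation.Binary.Core using (Rel)
open import Relation.Binary.PropositionalEquality.Core using (_≡_)
open import Relation.Binary.Structures using (IsDecTotalOrder)
open import Relation.Nullary.Decidable.Core using (does)
open import Relation.Nullary.Negation.Core using (¬_)

-- Stands in for ℝ with its classical (decidable) order. Completeness is not
-- required, so ℝ is an instance, and so is ℚ.
record ArchimedeanField c ℓ₁ ℓ₂ : Set (lsuc (c ⊔ ℓ₁ ⊔ ℓ₂)) where
  field
    commutativeRing : CommutativeRing c ℓ₁
  open CommutativeRing commutativeRing public
  open SemiringMult semiring public using () renaming (_×_ to _·_)

  infix  4 _≤_ _<_
  infix  8 _⁻¹
  field
    _≤_             : Rel Carrier ℓ₂
    isDecTotalOrder : IsDecTotalOrder _≈_ _≤_
    0≉1             : ¬ (0# ≈ 1#)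
    -- total, with the convention 0⁻¹ = 0
    _⁻¹             : Carrier → Carrier
    ⁻¹-inverse      : ∀ x → ¬ (x ≈ 0#) → x * x ⁻¹ ≈ 1#
    0⁻¹≈0           : 0# ⁻¹ ≈ 0#
    +-monoˡ-≤       : ∀ z {x y} → x ≤ y → x + z ≤ y + z
    *-nonNeg        : ∀ {x y} → 0# ≤ x → 0# ≤ y → 0# ≤ x * y

  open IsDecTotalOrder isDecTotalOrder public using (_≤?_; _≟_)

  _<_ : Rel Carrier (ℓ₁ ⊔ ℓ₂)
  x < y = x ≤ y × ¬ (x ≈ y)

  fromℕ : ℕ → Carrier
  fromℕ n = n · 1#

  field
    archimedean     : ∀ x → ∃[ n ] x ≤ fromℕ n

-- log k inside O(·), shifted so that it does not vanish at k = 1.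
log : ℕ → ℕ
log m = ⌈log₂ suc m ⌉

module Streaming {c ℓ₁ ℓ₂ : Level} (𝔽 : ArchimedeanField c ℓ₁ ℓ₂) where
  open ArchimedeanField 𝔽

  NonNegative : ∀ {n} → (Subset n → Carrier) → Set ℓ₂
  NonNegative f = ∀ S → 0# ≤ f S

  Submodular : ∀ {n} → (Subset n → Carrier) → Set ℓ₂
  Submodular f = ∀ S T → f (S ∪ T) + f (S ∩ T) ≤ f S + f T

  -- The ground set N is Fin n; the stream lists every element exactly once.
  record Instance : Set (c ⊔ ℓ₂) where
    field
      n           : ℕ
      f           : Subset n → Carrier
      nonNegative : NonNegative f
      submodular  : Submodular f
      stream      : List (Fin n)
      arrival     : stream ↭ allFin n

  IsOptimal : ∀ {n} → (Subset n → Carrier) → ℕ → Subset n → Set ℓ₂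
  IsOptimal f k OPT = ∣ OPT ∣ ℕ.≤ k × (∀ T → ∣ T ∣ ℕ.≤ k → f T ≤ f OPT)

  -- A machine's memory consists of a control state, a vector of numbers and a
  -- vector of stored ground-set elements. Elements are opaque tokens: they
  -- enter memory only from the stream, can only be kept, copied or dropped,
  -- and f can only be queried on sets of elements currently in memory.
  -- Numbers are manipulated only by field operations and comparisons;
  -- as usual for real arithmetic, each occupies one word.

  data Expr (r : ℕ) : Set c where
    var   : Fin r → Expr r
    con   : Carrier → Expr r
    _⊕_   : Expr r → Expr r → Expr r
    _⊗_   : Expr r → Expr r → Expr r
    ⊖_    : Expr r → Expr r
    _⁻¹′  : Expr r → Expr r

  ⟦_⟧ : ∀ {r} → Expr r → Vec Carrier r → Carrier
  ⟦ var i   ⟧ ρ = lookup ρ i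
  ⟦ con x   ⟧ ρ = x
  ⟦ a ⊕ b   ⟧ ρ = ⟦ a ⟧ ρ + ⟦ b ⟧ ρ
  ⟦ a ⊗ b   ⟧ ρ = ⟦ a ⟧ ρ * ⟦ b ⟧ ρ
  ⟦ ⊖ a     ⟧ ρ = - ⟦ a ⟧ ρ
  ⟦ a ⁻¹′   ⟧ ρ = ⟦ a ⟧ ρ ⁻¹

  data DecisionTree {a} (r : ℕ) (A : Set a) : Set (c ⊔ a) where
    leaf            : A → DecisionTree r A
    if_≤_then_else_ : Expr r → Expr r →
                      DecisionTree r A → DecisionTree r A → DecisionTree r A

  decide : ∀ {a r} {A : Set a} → DecisionTree r A → Vec Carrier r → A
  decide (leaf x) ρ = x
  decide (if a ≤ b then t else u) ρ =
    if does (⟦ a ⟧ ρ ≤? ⟦ b ⟧ ρ) then decide t ρ else decide u ρ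

  module _ {Control : Set} (numbers elements : Control → ℕ) where

    -- New memory contents, computed from r available numbers and s
    -- available elements.
    record Next (r s : ℕ) : Set c where
      constructor goto
      field
        target      : Control
        newNumbers  : Vec (Expr r) (numbers target)
        newElements : Vec (Fin s) (elements target)

    data Action (r s : ℕ) : Set (c ⊔ ℓ₂) where
      move   : Next r s → Action r s
      -- the oracle's answer becomes number zero
      query  : Subset s → Next (suc r) s → Action r s
      -- the arriving element becomes element zero; the second continuation
      -- is taken when the stream is exhausted
      read   : Next r (suc s) → Next r s → Action r s
      -- first continuation with probability p, second with 1 - p
      flip   : (p : Carrier) → 0# ≤ p → p ≤ 1# →
               Next r s → Next r s → Action r s
      output : Subset s → Action r s

  record Machine : Set (lsuc Level.zero ⊔ c ⊔ ℓ₂) where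
    field
      Control          : Set
      encode           : Control → List Bool
      encode-injective : Injective _≡_ _≡_ encode
      numbers          : Control → ℕ
      elements         : Control → ℕ
      start            : Next numbers elements 0 0
      program          : (q : Control) →
        DecisionTree (numbers q) (Action numbers elements (numbers q) (elements q))

  contents : ∀ {n s} → Vec (Fin n) s → Subset s → Subset n
  contents []       []          = ⊥
  contents (x ∷ xs) (true  ∷ q) = ⁅ x ⁆ ∪ contents xs q
  contents (x ∷ xs) (false ∷ q) = contents xs q

  data Dist (n : ℕ) : Set c where
    return : Subset n → Dist n
    mix    : Carrier → Dist n → Dist n → Dist n

  𝔼 : ∀ {n} → (Subset n → Carrier) → Dist n → Carrier
  𝔼 f (return S)  = f S
  𝔼 f (mix p D E) = p * 𝔼 f D + (1# - p) * 𝔼 f E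

  -- Every branch counts, including those of probability zero.
  data Always {n p} (P : Subset n → Set p) : Dist n → Set (c ⊔ p) where
    return : ∀ {S} → P S → Always P (return S)
    mix    : ∀ {p D E} → Always P D → Always P E → Always P (mix p D E)

  module Execution (M : Machine) {n : ℕ} (f : Subset n → Carrier) where
    open Machine M

    record Config : Set c where
      constructor config
      field
        control   : Control
        numVec    : Vec Carrier (numbers control)
        eltVec    : Vec (Fin n) (elements control)
        remaining : List (Fin n)

    enter : ∀ {r s} → Next numbers elements r s →
            Vec Carrier r → Vec (Fin n) s → List (Fin n) → Config
    enter (goto q es is) ρ σ rest =
      config q (Vec.map (λ e → ⟦ e ⟧ ρ) es) (Vec.map (lookup σ) is) rest

    data Result : Set c where
      halt : Subset n → Result
      step : Config → Result
      coin : Carrier → Config → Config → Result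

    perform : ∀ {r s} → Action numbers elements r s →
              Vec Carrier r → Vec (Fin n) s → List (Fin n) → Result
    perform (move k)         ρ σ xs       = step (enter k ρ σ xs)
    perform (query q k)      ρ σ xs       = step (enter k (f (contents σ q) ∷ ρ) σ xs)
    perform (read k e)       ρ σ []       = step (enter e ρ σ [])
    perform (read k e)       ρ σ (x ∷ xs) = step (enter k ρ (x ∷ σ) xs)
    perform (flip p _ _ k l) ρ σ xs       = coin p (enter k ρ σ xs) (enter l ρ σ xs)
    perform (output q)       ρ σ xs       = halt (contents σ q)

    next : Config → Result
    next (config q ρ σ xs) = perform (decide (program q) ρ) ρ σ xs

    infix 4 _↝_ _⇓_

    data _↝_ (x : Config) : Config → Set c where
      step  : ∀ {y}     → next x ≡ step y     → x ↝ y
      coinˡ : ∀ {p y z} → next x ≡ coin p y z → x ↝ y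
      coinʳ : ∀ {p y z} → next x ≡ coin p y z → x ↝ z

    -- x ⇓ D: started at x the machine halts for all outcomes of its coins,
    -- and its output has distribution D.
    data _⇓_ (x : Config) : Dist n → Set c where
      halt : ∀ {S} → next x ≡ halt S → x ⇓ return S
      step : ∀ {y D} → next x ≡ step y → y ⇓ D → x ⇓ D
      coin : ∀ {p y z D E} → next x ≡ coin p y z →
             y ⇓ D → z ⇓ E → x ⇓ mix p D E

    initial : List (Fin n) → Config
    initial xs = enter start [] [] xs

    Reachable : List (Fin n) → Config → Set c
    Reachable xs x = Star _↝_ (initial xs) x

    storedElements : Config → ℕ
    storedElements x = elements (Config.control x)

    -- Bits for the control state, a word per number, and log n bits for
    -- the identity of each stored element.
    memory : Config → ℕ
    memory x = List.length (encode q) ℕ.+ numbers q ℕ.+ elements q ℕ.* log n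
      where q = Config.control x

  -- The machine may depend on k, but not on N, |N| or f.

  StreamingAlgorithm : Set (lsuc Level.zero ⊔ c ⊔ ℓ₂)
  StreamingAlgorithm = (k : ℕ) → Machine

  IsApproximation : Carrier → StreamingAlgorithm → Set (c ⊔ ℓ₂)
  IsApproximation β alg =
    ∀ k → 1 ℕ.≤ k → (I : Instance) →
    let open Instance I
        open Execution (alg k) f
    in ∃[ D ] initial stream ⇓ D
            × Always (λ S → ∣ S ∣ ℕ.≤ k) D
            × (∀ OPT → IsOptimal f k OPT → f OPT * β ⁻¹ ≤ 𝔼 f D)

  -- memory O(k · polylog(k, |N|))
  IsSemiStreaming : StreamingAlgorithm → Set (c ⊔ ℓ₂)
  IsSemiStreaming alg =
    ∃[ A ] ∃[ d ] ∀ k → 1 ℕ.≤ k → (I : Instance) →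
    let open Instance I
        open Execution (alg k) f
    in ∀ x → Reachable stream x →
       memory x ℕ.≤ A ℕ.* (k ℕ.* (log k ℕ.+ log n) ℕ.^ d)

  StoresAtMost : (ℕ → Carrier) → StreamingAlgorithm → Set (c ⊔ ℓ₂)
  StoresAtMost bound alg =
    ∀ k → 1 ℕ.≤ k → (I : Instance) →
    let open Instance I
        open Execution (alg k) f
    in ∀ x → Reachable stream x → fromℕ (storedElements x) ≤ bound k

{-# OPTIONS --safe #-}
module Submission where

import Algebra.Properties.Ring as RingProperties
import Algebra.Properties.Semiring.Exp as Exp
import Algebra.Properties.Semiring.Mult as Mult
import Algebra.Solver.Ring.NaturalCoefficients.Default as Solver
open import Data.Bool.Base using (Bool; true; false; if_then_else_)
open import Data.Fin.Base as Fin using (Fin; zero; suc; toℕ; inject₁; combine; remQuot)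
open import Data.Fin.Induction using (<-weakInduction)
import Data.Fin.Properties as Fin
open import Data.Fin.Subset using (Subset; ⊥; ⁅_⁆; _∪_; _∩_; ∁; ∣_∣; _∈_; _∉_; _⊆_; Nonempty) renaming (_-_ to _∖_)
open import Data.Fin.Subset.Properties
open import Data.List.Base as List using (List; []; _∷_; _++_; length)
open import Data.List.Membership.Propositional using () renaming (_∈_ to _∈ₗ_)
open import Data.List.Membership.Propositional.Properties using (∈-allFin)
import Data.List.Properties as List
open import Data.List.Relation.Binary.Permutation.Propositional using (↭-sym; ↭⇒↭ₛ)
open import Data.List.Relation.Binary.Permutation.Propositional.Properties using (∈-resp-↭)
import Data.List.Relation.Binary.Permutation.Setoid.Properties as Permutation
open import Data.List.Relation.Unary.All as All using ()
open import Data.List.Relation.Unary.AllPairs using (_∷_)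
open import Data.List.Relation.Unary.Any using (here; there)
open import Data.List.Relation.Unary.Unique.Propositional using (Unique)
open import Data.List.Relation.Unary.Unique.Propositional.Properties using (allFin⁺)
open import Data.Nat.Base as ℕ using (ℕ; zero; suc)
open import Data.Nat.Induction using (<-rec)
open import Data.Nat.Logarithm using (⌈log₂_⌉; ⌈log₂⌈n/2⌉⌉≡⌈log₂n⌉∸1; ⌈log₂⌉-mono-≤)
import Data.Nat.Properties as ℕ
open import Data.Nat.Tactic.RingSolver using (solve-∀)
open import Data.Product.Base using (Σ; ∃-syntax; _×_; _,_; proj₁; proj₂)
open import Data.Sum.Base as Sum using (_⊎_; inj₁; inj₂; [_,_])
open import Data.Unit.Base using (⊤; tt)
open import Data.Vec.Base as Vec using (Vec; []; _∷_; lookup; _[_]≔_; updateAt; replicate; allFin; _∷ʳ_; here; there)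
import Data.Vec.Properties as Vec
open import Function.Base using (_∘_)
open import Level using (_⊔_)
open import Relation.Binary.Bundles using (Poset)
open import Relation.Binary.PropositionalEquality using (_≡_; _≢_; refl; sym; trans; cong; cong₂; subst; setoid)
import Relation.Binary.Reasoning.PartialOrder as PartialOrderReasoning
open import Relation.Binary.Structures using (IsDecTotalOrder)
open import Relation.Nullary.Decidable using (Dec; yes; no; does; _×-dec_; ¬?; dec-true; dec-false)
open import Relation.Nullary.Negation using (¬_; contradiction)
open import Defs

-- For a guess τ of f(OPT)/3, keep p disjoint sets S₁, …, Sₚ and add an arriving element to some Sᵢ
-- with fewer than k elements to which it contributes more than τ/k. If some Sᵢ fills up, then
-- f(Sᵢ) ≥ τ. Otherwise the elements of OPT that were not kept add at most τ to any Sᵢ, so by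
-- subadditivity f(OPT ∪ Sᵢ) ≤ f(Sᵢ) + τ + f(OPT ∩ ⋃ S) ≤ 2 f(A) + τ, where A is the best stored
-- set of size at most k, found by exhaustive search. As the Sᵢ are disjoint, the average of
-- f(OPT ∪ Sᵢ) is at least (1 - 1/p) f(OPT), whence f(A) ≥ (1/3 - 1/(2p)) f(OPT).
--
-- The guesses are base · ρ^j for j < W, with ρ = 1 + ε/3. No element e can have joined a set with
-- τ ≥ k f({e}), so the sets of a guess that high are still empty: the window of guesses may move
-- upwards with the largest f({e}) seen so far, and W = O(ε⁻¹ log k) guesses suffice.

-- Stored elements are opaque tokens, so the candidate sets are kept in the control state as bit
-- masks over the slots of the element memory, next to the loop counters. The memory bound thus
-- becomes a bound on the length of a code for control states. Gains are compared after
-- multiplication by `k`, which avoids the quotient τ/k.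
--
-- Two conditions hold the window of guesses in place, with `R` = ρ^W: `base` is at most f(OPT)/3,
-- and k f({e}) ≤ `base * R` for every seen e. A new e forces a shift only if `base * R` < k f({e}).
-- Then R ≥ 6k and ρ ≤ 2 make the new lowest guess `base * ρ` at most f({e})/3 ≤ f(OPT)/3; the
-- requirement R ≥ 6k is what fixes W. If f({e})/3 is not below `base * R`, the window restarts at
-- f({e})/3 with empty sets. This also leaves the initial base 0, which no multiplication could do,
-- and it bounds the number of shifts per element.
--
-- Finally f(OPT)/3 may lie above the window. Then k f({e}) ≤ `base * R` for all e already gives
-- f(OPT) ≤ f(A) + `base * R`, and hence a ratio of 3/2.

-- Prefix-free binary codes

record Code (A : Set) : Set where
  field
    encode      : A → List Bool
    -- Decodability in front of an arbitrary continuation survives concatenation; mere injectivity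
    -- does not, and products are coded by concatenation.
    prefix-free : ∀ a b {u v} → encode a ++ u ≡ encode b ++ v → a ≡ b × u ≡ v
    maxLength   : ℕ
    bounded     : ∀ a → length (encode a) ℕ.≤ maxLength

  injective : ∀ {a b} → encode a ≡ encode b → a ≡ b
  injective {a} {b} eq = proj₁ (prefix-free a b (cong (_++ []) eq))

open Code

⊤-code : Code ⊤
⊤-code .encode _ = []
⊤-code .prefix-free tt tt eq = refl , eq
⊤-code .maxLength = 0
⊤-code .bounded _ = ℕ.z≤n

bool-code : Code Bool
bool-code .encode b = b ∷ []
bool-code .prefix-free _ _ eq = List.∷-injective eq
bool-code .maxLength = 1
bool-code .bounded _ = ℕ.≤-refl

infixr 2 _×-code_
infixr 1 _⊎-code_

_×-code_ : ∀ {A B} → Code A → Code B → Code (A × B)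
(c ×-code d) .encode (a , b) = encode c a ++ encode d b
(c ×-code d) .prefix-free (a , b) (a′ , b′) {u} {v} eq
  with refl , eq′ ← prefix-free c a a′
         (trans (sym (List.++-assoc (encode c a) _ u)) (trans eq (List.++-assoc (encode c a′) _ v)))
  with refl , eq″ ← prefix-free d b b′ eq′ = refl , eq″
(c ×-code d) .maxLength = maxLength c ℕ.+ maxLength d
(c ×-code d) .bounded (a , b) rewrite List.length-++ (encode c a) {encode d b} =
  ℕ.+-mono-≤ (bounded c a) (bounded d b)

_⊎-code_ : ∀ {A B} → Code A → Code B → Code (A ⊎ B)
(c ⊎-code d) .encode (inj₁ a) = true ∷ encode c a
(c ⊎-code d) .encode (inj₂ b) = false ∷ encode d b
(c ⊎-code d) .prefix-free (inj₁ a) (inj₁ a′) eq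
  with refl , eq′ ← prefix-free c a a′ (List.∷-injectiveʳ eq) = refl , eq′
(c ⊎-code d) .prefix-free (inj₂ b) (inj₂ b′) eq
  with refl , eq′ ← prefix-free d b b′ (List.∷-injectiveʳ eq) = refl , eq′
(c ⊎-code d) .maxLength = suc (maxLength c ℕ.+ maxLength d)
(c ⊎-code d) .bounded (inj₁ a) = ℕ.s≤s (ℕ.m≤n⇒m≤n+o _ (bounded c a))
(c ⊎-code d) .bounded (inj₂ b) = ℕ.s≤s (ℕ.m≤n⇒m≤o+n _ (bounded d b))

vec-code : ∀ {A} → Code A → ∀ n → Code (Vec A n)
vec-code c zero .encode [] = []
vec-code c zero .prefix-free [] [] eq = refl , eq
vec-code c zero .maxLength = 0
vec-code c zero .bounded [] = ℕ.z≤n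
vec-code c (suc n) .encode (x ∷ xs) = encode (c ×-code vec-code c n) (x , xs)
vec-code c (suc n) .prefix-free (x ∷ xs) (y ∷ ys) eq
  with refl , eq′ ← prefix-free (c ×-code vec-code c n) (x , xs) (y , ys) eq = refl , eq′
vec-code c (suc n) .maxLength = maxLength (c ×-code vec-code c n)
vec-code c (suc n) .bounded (x ∷ xs) = bounded (c ×-code vec-code c n) (x , xs)

vec-maxLength : ∀ {A} (c : Code A) n → maxLength (vec-code c n) ≡ n ℕ.* maxLength c
vec-maxLength c zero    = refl
vec-maxLength c (suc n) = cong (maxLength c ℕ.+_) (vec-maxLength c n)

retract-code : ∀ {A B} (to : A → B) (from : B → A) → (∀ a → from (to a) ≡ a) → Code B → Code A
retract-code to from from∘to c .encode = encode c ∘ to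
retract-code to from from∘to c .prefix-free a b eq
  with eq₁ , eq₂ ← prefix-free c (to a) (to b) eq =
  trans (sym (from∘to a)) (trans (cong from eq₁) (from∘to b)) , eq₂
retract-code to from from∘to c .maxLength = maxLength c
retract-code to from from∘to c .bounded = bounded c ∘ to

-- One extra bit tells `zero` apart. Iterated, this is the unary code `fin-code`; applied once to a
-- binary code, it adds the end position of a countdown.
suc-code : ∀ {n} → Code (Fin n) → Code (Fin (suc n))
suc-code {n} c = retract-code to from (λ { zero → refl ; (suc i) → refl }) (⊤-code ⊎-code c)
  where
  to : Fin (suc n) → ⊤ ⊎ Fin n
  to zero    = inj₁ tt
  to (suc i) = inj₂ i
  from : ⊤ ⊎ Fin n → Fin (suc n)
  from (inj₁ _) = zero
  from (inj₂ i) = suc i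

fin-code : ∀ n → Code (Fin n)
fin-code zero .encode ()
fin-code zero .prefix-free ()
fin-code zero .maxLength = 0
fin-code zero .bounded ()
fin-code (suc n) = suc-code (fin-code n)

fin-maxLength : ∀ n → maxLength (fin-code n) ≡ n
fin-maxLength zero    = refl
fin-maxLength (suc n) = cong suc (fin-maxLength n)

subset-code : ∀ n → Code (Subset n)
subset-code = vec-code bool-code

-- Binary numbering of subsets

toBool : Fin 2 → Bool
toBool zero    = false
toBool (suc _) = true

fromBool : Bool → Fin 2
fromBool false = zero
fromBool true  = suc zero

fromBool∘toBool : ∀ i → fromBool (toBool i) ≡ i
fromBool∘toBool zero       = refl
fromBool∘toBool (suc zero) = refl

toBool∘fromBool : ∀ b → toBool (fromBool b) ≡ b
toBool∘fromBool false = refl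
toBool∘fromBool true  = refl

-- The binary expansion of an index is the characteristic vector of a subset.
rank : ∀ {n} → Subset n → Fin (2 ℕ.^ n)
rank []      = zero
rank (b ∷ S) = combine (fromBool b) (rank S)

unrank : ∀ n → Fin (2 ℕ.^ n) → Subset n
unrank zero    _ = []
unrank (suc n) t = toBool (proj₁ b,r) ∷ unrank n (proj₂ b,r)
  where b,r = remQuot {2} (2 ℕ.^ n) t

unrank∘rank : ∀ {n} (S : Subset n) → unrank n (rank S) ≡ S
unrank∘rank []      = refl
unrank∘rank {suc n} (b ∷ S) = cong₂ _∷_
  (trans (cong (toBool ∘ proj₁) (Fin.remQuot-combine (fromBool b) (rank S))) (toBool∘fromBool b))
  (trans (cong (unrank n ∘ proj₂) (Fin.remQuot-combine (fromBool b) (rank S))) (unrank∘rank S))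

rank∘unrank : ∀ n (t : Fin (2 ℕ.^ n)) → rank (unrank n t) ≡ t
rank∘unrank zero    zero = refl
rank∘unrank (suc n) t    = trans
  (cong₂ combine (fromBool∘toBool (proj₁ b,r)) (rank∘unrank n (proj₂ b,r)))
  (Fin.combine-remQuot {2} (2 ℕ.^ n) t)
  where b,r = remQuot {2} (2 ℕ.^ n) t

-- Unary codes would be exponentially long here.
cursor-code : ∀ n → Code (Fin (2 ℕ.^ n))
cursor-code n = retract-code (unrank n) rank (rank∘unrank n) (subset-code n)

-- Logarithms

-- Halving: `n` is at most twice ⌈n/2⌉, whose rounded logarithm is smaller by one as soon as `n` is
-- at least 2.
n≤2^⌈log₂n⌉ : ∀ n → n ℕ.≤ 2 ℕ.^ ⌈log₂ n ⌉
n≤2^⌈log₂n⌉ = <-rec _ go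
  where
  open ℕ.≤-Reasoning
  go : ∀ n → (∀ {m} → m ℕ.< n → m ℕ.≤ 2 ℕ.^ ⌈log₂ m ⌉) → n ℕ.≤ 2 ℕ.^ ⌈log₂ n ⌉
  go 0 _ = ℕ.z≤n
  go 1 _ = ℕ.≤-refl
  go n@(suc (suc m)) rec = begin
    n                                  ≡⟨ ℕ.⌊n/2⌋+⌈n/2⌉≡n n ⟨
    ℕ.⌊ n /2⌋ ℕ.+ ℕ.⌈ n /2⌉            ≤⟨ ℕ.+-monoˡ-≤ _ (ℕ.⌊n/2⌋≤⌈n/2⌉ n) ⟩
    ℕ.⌈ n /2⌉ ℕ.+ ℕ.⌈ n /2⌉            ≡⟨ cong (ℕ.⌈ n /2⌉ ℕ.+_) (ℕ.+-identityʳ _) ⟨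
    2 ℕ.* ℕ.⌈ n /2⌉                    ≤⟨ ℕ.*-monoʳ-≤ 2 (rec (ℕ.⌈n/2⌉<n m)) ⟩
    2 ℕ.^ suc ⌈log₂ ℕ.⌈ n /2⌉ ⌉        ≡⟨ cong (λ l → 2 ℕ.^ suc l) (⌈log₂⌈n/2⌉⌉≡⌈log₂n⌉∸1 n) ⟩
    2 ℕ.^ suc (⌈log₂ n ⌉ ℕ.∸ 1)        ≡⟨ cong (2 ℕ.^_) (ℕ.m+[n∸m]≡n (⌈log₂⌉-mono-≤ {2} {n} (ℕ.s≤s (ℕ.s≤s ℕ.z≤n)))) ⟩
    2 ℕ.^ ⌈log₂ n ⌉                    ∎

-- Lets additive constants be absorbed into multiples of `log k`, also at `k` = 1.
1≤log : ∀ {k} → 1 ℕ.≤ k → 1 ℕ.≤ log k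
1≤log {suc k} _ = ⌈log₂⌉-mono-≤ {2} {suc (suc k)} (ℕ.s≤s (ℕ.s≤s ℕ.z≤n))

-- Arithmetic in an Archimedean field

module Arithmetic {c ℓ₁ ℓ₂} (𝔽 : ArchimedeanField c ℓ₁ ℓ₂) where
  open ArchimedeanField 𝔽 renaming (refl to ≈-refl; sym to ≈-sym; trans to ≈-trans; reflexive to ≈-reflexive)
  open IsDecTotalOrder isDecTotalOrder public using (isPartialOrder) renaming
    (refl to ≤-refl; trans to ≤-trans; reflexive to ≤-reflexive; antisym to ≤-antisym; total to ≤-total)
  open Mult semiring using (×1-homo-*)
  open Exp semiring public using (_^_; ^-assocʳ)
  open RingProperties ring using (-‿distribˡ-*; -‿involutive)
  open Solver commutativeSemiring public using (solve; _:=_; _:+_; _:*_; con; Polynomial)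

  ≤-poset : Poset _ _ _
  ≤-poset = record { isPartialOrder = isPartialOrder }

  module ≤-Reasoning = PartialOrderReasoning ≤-poset
  open ≤-Reasoning

  -- The solver's own numerals do not unfold to those of fromℕ.
  :ℕ : ∀ {m} → ℕ → Polynomial m
  :ℕ zero    = con 0
  :ℕ (suc n) = con 1 :+ :ℕ n

  ≰⇒≥ : ∀ {x y} → ¬ x ≤ y → y ≤ x
  ≰⇒≥ {x} {y} x≰y with ≤-total x y
  ... | inj₁ x≤y = contradiction x≤y x≰y
  ... | inj₂ y≤x = y≤x

  +-mono-≤ : ∀ {x y u v} → x ≤ y → u ≤ v → x + u ≤ y + v
  +-mono-≤ {x} {y} {u} {v} x≤y u≤v = begin
    x + u  ≤⟨ +-monoˡ-≤ u x≤y ⟩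
    y + u  ≈⟨ +-comm y u ⟩
    u + y  ≤⟨ +-monoˡ-≤ y u≤v ⟩
    v + y  ≈⟨ +-comm v y ⟩
    y + v  ∎

  +-monoʳ-≤ : ∀ z {x y} → x ≤ y → z + x ≤ z + y
  +-monoʳ-≤ z = +-mono-≤ ≤-refl

  +-cancelʳ-≤ : ∀ z {x y} → x + z ≤ y + z → x ≤ y
  +-cancelʳ-≤ z {x} {y} x+z≤y+z = begin
    x            ≈⟨ undo x ⟨
    x + z - z    ≤⟨ +-monoˡ-≤ (- z) x+z≤y+z ⟩
    y + z - z    ≈⟨ undo y ⟩
    y            ∎
    where
    undo : ∀ w → w + z - z ≈ w
    undo w = ≈-trans (+-assoc w z (- z)) (≈-trans (+-congˡ (-‿inverseʳ z)) (+-identityʳ w))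

  x≤x+y : ∀ x {y} → 0# ≤ y → x ≤ x + y
  x≤x+y x {y} 0≤y = ≤-trans (≤-reflexive (≈-sym (+-identityʳ x))) (+-monoʳ-≤ x 0≤y)

  +-nonNeg : ∀ {x y} → 0# ≤ x → 0# ≤ y → 0# ≤ x + y
  +-nonNeg {x} 0≤x 0≤y = ≤-trans 0≤x (x≤x+y x 0≤y)

  *-monoˡ-≤ : ∀ {z x y} → 0# ≤ z → x ≤ y → z * x ≤ z * y
  *-monoˡ-≤ {z} {x} {y} 0≤z x≤y = begin
    z * x                  ≤⟨ x≤x+y (z * x) (*-nonNeg 0≤z 0≤y-x) ⟩
    z * x + z * (y - x)    ≈⟨ distribˡ z x (y - x) ⟨
    z * (x + (y - x))      ≈⟨ *-congˡ (≈-trans (+-comm x (y - x)) (≈-trans (+-assoc y (- x) x)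
                                (≈-trans (+-congˡ (-‿inverseˡ x)) (+-identityʳ y)))) ⟩
    z * y                  ∎
    where
    0≤y-x : 0# ≤ y - x
    0≤y-x = ≤-trans (≤-reflexive (≈-sym (-‿inverseʳ x))) (+-monoˡ-≤ (- x) x≤y)

  *-monoʳ-≤ : ∀ {z x y} → 0# ≤ z → x ≤ y → x * z ≤ y * z
  *-monoʳ-≤ {z} {x} {y} 0≤z x≤y = begin
    x * z  ≈⟨ *-comm x z ⟩
    z * x  ≤⟨ *-monoˡ-≤ 0≤z x≤y ⟩
    z * y  ≈⟨ *-comm z y ⟩
    y * z  ∎

  *-mono-≤ : ∀ {x y u v} → 0# ≤ u → 0# ≤ y → x ≤ y → u ≤ v → x * u ≤ y * v
  *-mono-≤ 0≤u 0≤y x≤y u≤v = ≤-trans (*-monoʳ-≤ 0≤u x≤y) (*-monoˡ-≤ 0≤y u≤v)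

  0≤1 : 0# ≤ 1#
  0≤1 with ≤-total 0# 1#
  ... | inj₁ 0≤1 = 0≤1
  ... | inj₂ 1≤0 = begin
    0#             ≤⟨ *-nonNeg 0≤-1 0≤-1 ⟩
    - 1# * - 1#    ≈⟨ -‿distribˡ-* 1# (- 1#) ⟨
    - (1# * - 1#)  ≈⟨ -‿cong (*-identityˡ (- 1#)) ⟩
    - (- 1#)       ≈⟨ -‿involutive 1# ⟩
    1#             ∎
    where
    0≤-1 : 0# ≤ - 1#
    0≤-1 = ≤-trans (≤-reflexive (≈-sym (-‿inverseʳ 1#)))
             (≤-trans (+-monoˡ-≤ (- 1#) 1≤0) (≤-reflexive (+-identityˡ (- 1#))))

  1≰0 : ¬ 1# ≤ 0#
  1≰0 1≤0 = 0≉1 (≤-antisym 0≤1 1≤0)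

  0≤fromℕ : ∀ n → 0# ≤ fromℕ n
  0≤fromℕ zero    = ≤-refl
  0≤fromℕ (suc n) = +-nonNeg 0≤1 (0≤fromℕ n)

  fromℕ-mono-≤ : ∀ {m n} → m ℕ.≤ n → fromℕ m ≤ fromℕ n
  fromℕ-mono-≤ {n = n} ℕ.z≤n = 0≤fromℕ n
  fromℕ-mono-≤ (ℕ.s≤s m≤n)   = +-monoʳ-≤ 1# (fromℕ-mono-≤ m≤n)

  fromℕ-* : ∀ m n → fromℕ (m ℕ.* n) ≈ fromℕ m * fromℕ n
  fromℕ-* = ×1-homo-*

  1≤⇒0< : ∀ {x} → 1# ≤ x → 0# < x
  1≤⇒0< 1≤x = ≤-trans 0≤1 1≤x , λ 0≈x → 1≰0 (≤-trans 1≤x (≤-reflexive (≈-sym 0≈x)))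

  1≤fromℕ : ∀ {n} → 1 ℕ.≤ n → 1# ≤ fromℕ n
  1≤fromℕ 1≤n = ≤-trans (≤-reflexive (≈-sym (+-identityʳ 1#))) (fromℕ-mono-≤ 1≤n)

  0<fromℕ : ∀ {n} → 1 ℕ.≤ n → 0# < fromℕ n
  0<fromℕ 1≤n = 1≤⇒0< (1≤fromℕ 1≤n)

  inverseʳ : ∀ {x} → 0# < x → x * x ⁻¹ ≈ 1#
  inverseʳ (_ , 0≉x) = ⁻¹-inverse _ (λ x≈0 → 0≉x (≈-sym x≈0))

  0≤⁻¹ : ∀ {x} → 0# < x → 0# ≤ x ⁻¹
  0≤⁻¹ {x} 0<x with ≤-total 0# (x ⁻¹)
  ... | inj₁ 0≤x⁻¹ = 0≤x⁻¹
  ... | inj₂ x⁻¹≤0 = contradiction 1≤0 1≰0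
    where
    1≤0 : 1# ≤ 0#
    1≤0 = begin
      1#        ≈⟨ inverseʳ 0<x ⟨
      x * x ⁻¹  ≤⟨ *-monoˡ-≤ (proj₁ 0<x) x⁻¹≤0 ⟩
      x * 0#    ≈⟨ zeroʳ x ⟩
      0#        ∎

  *-cancelˡ-≤ : ∀ {z x y} → 0# < z → z * x ≤ z * y → x ≤ y
  *-cancelˡ-≤ {z} {x} {y} 0<z zx≤zy = begin
    x               ≈⟨ undo x ⟨
    z ⁻¹ * (z * x)  ≤⟨ *-monoˡ-≤ (0≤⁻¹ 0<z) zx≤zy ⟩
    z ⁻¹ * (z * y)  ≈⟨ undo y ⟩
    y               ∎
    where
    undo : ∀ w → z ⁻¹ * (z * w) ≈ w
    undo w = ≈-trans (≈-sym (*-assoc (z ⁻¹) z w))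
      (≈-trans (*-congʳ (≈-trans (*-comm (z ⁻¹) z) (inverseʳ 0<z))) (*-identityˡ w))

  x≤z*y⇒x*z⁻¹≤y : ∀ {x y z} → 0# < z → x ≤ z * y → x * z ⁻¹ ≤ y
  x≤z*y⇒x*z⁻¹≤y {x} {y} {z} 0<z x≤zy = *-cancelˡ-≤ 0<z (begin
    z * (x * z ⁻¹)  ≈⟨ solve 3 (λ z x w → z :* (x :* w) := x :* (z :* w)) ≈-refl z x (z ⁻¹) ⟩
    x * (z * z ⁻¹)  ≈⟨ *-congˡ (inverseʳ 0<z) ⟩
    x * 1#          ≈⟨ *-identityʳ x ⟩
    x               ≤⟨ x≤zy ⟩
    z * y           ∎)

  0≤^ : ∀ {x} → 0# ≤ x → ∀ n → 0# ≤ x ^ n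
  0≤^ 0≤x zero    = 0≤1
  0≤^ 0≤x (suc n) = *-nonNeg 0≤x (0≤^ 0≤x n)

  1≤^ : ∀ {x} → 1# ≤ x → ∀ n → 1# ≤ x ^ n
  1≤^ 1≤x zero    = ≤-refl
  1≤^ {x} 1≤x (suc n) = begin
    1#         ≈⟨ *-identityˡ 1# ⟨
    1# * 1#    ≤⟨ *-mono-≤ 0≤1 (≤-trans 0≤1 1≤x) 1≤x (1≤^ 1≤x n) ⟩
    x * x ^ n  ∎

  -- Bounds the number of guesses after which the threshold has doubled. The induction step discards
  -- the quadratic term.
  bernoulli : ∀ {a} → 0# ≤ a → ∀ n → 1# + fromℕ n * a ≤ (1# + a) ^ n
  bernoulli {a} 0≤a zero    = ≤-reflexive (≈-trans (+-congˡ (zeroˡ a)) (+-identityʳ 1#))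
  bernoulli {a} 0≤a (suc n) = begin
    1# + (1# + fromℕ n) * a
      ≤⟨ x≤x+y _ (*-nonNeg 0≤a (*-nonNeg (0≤fromℕ n) 0≤a)) ⟩
    1# + (1# + fromℕ n) * a + a * (fromℕ n * a)
      ≈⟨ solve 2 (λ m a → con 1 :+ (con 1 :+ m) :* a :+ a :* (m :* a) := (con 1 :+ a) :* (con 1 :+ m :* a))
              ≈-refl (fromℕ n) a ⟩
    (1# + a) * (1# + fromℕ n * a)
      ≤⟨ *-monoˡ-≤ (+-nonNeg 0≤1 0≤a) (bernoulli 0≤a n) ⟩
    (1# + a) * (1# + a) ^ n  ∎

  2^≤^ : ∀ {x} → fromℕ 2 ≤ x → ∀ n → fromℕ (2 ℕ.^ n) ≤ x ^ n
  2^≤^ 2≤x zero    = ≤-reflexive (+-identityʳ 1#)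
  2^≤^ {x} 2≤x (suc n) = begin
    fromℕ (2 ℕ.* 2 ℕ.^ n)       ≈⟨ fromℕ-* 2 (2 ℕ.^ n) ⟩
    fromℕ 2 * fromℕ (2 ℕ.^ n)   ≤⟨ *-mono-≤ (0≤fromℕ (2 ℕ.^ n)) (≤-trans (0≤fromℕ 2) 2≤x) 2≤x (2^≤^ 2≤x n) ⟩
    x * x ^ n                   ∎

  -- A discrete intermediate value theorem, by scanning down from the top. It places f(OPT)/3
  -- between two consecutive guesses.
  crossing : ∀ (a : ℕ → Carrier) {v} n → a 0 ≤ v → v ≤ a (suc n) →
             ∃[ j ] j ℕ.< suc n × a j ≤ v × v ≤ a (suc j)
  crossing a {v} zero    a₀≤v v≤a₁ = 0 , ℕ.s≤s ℕ.z≤n , a₀≤v , v≤a₁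
  crossing a {v} (suc n) a₀≤v v≤a with a (suc n) ≤? v
  ... | yes aₙ≤v = suc n , ℕ.≤-refl , aₙ≤v , v≤a
  ... | no  aₙ≰v with j , j<n , low , high ← crossing a n a₀≤v (≰⇒≥ aₙ≰v) = j , ℕ.m<n⇒m<1+n j<n , low , high

  -- Descend from the Archimedean bound while the predecessor still dominates `x`. At the last value
  -- the predecessor is at most `x`, and the remaining 1 is at most `x` too, whence the factor 2.
  least-fromℕ-above : ∀ {x} → 1# ≤ x → ∃[ q ] 1 ℕ.≤ q × x ≤ fromℕ q × fromℕ q ≤ fromℕ 2 * x
  least-fromℕ-above {x} 1≤x = search (proj₁ (archimedean x)) (proj₂ (archimedean x))
    where
    search : ∀ n → x ≤ fromℕ n → ∃[ q ] 1 ℕ.≤ q × x ≤ fromℕ q × fromℕ q ≤ fromℕ 2 * x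
    search zero    x≤0 = contradiction (≤-trans 1≤x x≤0) 1≰0
    search (suc n) x≤n with x ≤? fromℕ n
    ... | yes x≤n′ = search n x≤n′
    ... | no  x≰n  = suc n , ℕ.s≤s ℕ.z≤n , x≤n , (begin
      1# + fromℕ n   ≤⟨ +-mono-≤ 1≤x (≰⇒≥ x≰n) ⟩
      x + x          ≈⟨ solve 1 (λ x → x :+ x := :ℕ 2 :* x) ≈-refl x ⟩
      fromℕ 2 * x    ∎)

-- Finite unions

⋃ᶠ : ∀ {p n} → (Fin p → Subset n) → Subset n
⋃ᶠ {zero}  S = ⊥
⋃ᶠ {suc p} S = S zero ∪ ⋃ᶠ (S ∘ suc)

∈⋃ᶠ⁺ : ∀ {p n} (S : Fin p → Subset n) {x} i → x ∈ S i → x ∈ ⋃ᶠ S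
∈⋃ᶠ⁺ S zero    x∈S = x∈p∪q⁺ (inj₁ x∈S)
∈⋃ᶠ⁺ S (suc i) x∈S = x∈p∪q⁺ (inj₂ (∈⋃ᶠ⁺ (S ∘ suc) i x∈S))

∈⋃ᶠ⁻ : ∀ {p n} (S : Fin p → Subset n) {x} → x ∈ ⋃ᶠ S → ∃[ i ] x ∈ S i
∈⋃ᶠ⁻ {zero}  S x∈ = contradiction x∈ ∉⊥
∈⋃ᶠ⁻ {suc p} S x∈ with x∈p∪q⁻ (S zero) _ x∈
... | inj₁ x∈S₀ = zero , x∈S₀
... | inj₂ x∈S′ with i , x∈Sᵢ ← ∈⋃ᶠ⁻ (S ∘ suc) x∈S′ = suc i , x∈Sᵢ

⁅x⁆∪[p∖x] : ∀ {n} {p : Subset n} {x} → x ∈ p → ⁅ x ⁆ ∪ (p ∖ x) ≡ p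
⁅x⁆∪[p∖x] {p = p} {x} x∈p = ⊆-antisym to from
  where
  to : ⁅ x ⁆ ∪ (p ∖ x) ⊆ p
  to y∈ with x∈p∪q⁻ ⁅ x ⁆ (p ∖ x) y∈
  ... | inj₁ y∈⁅x⁆ rewrite x∈⁅y⁆⇒x≡y x y∈⁅x⁆ = x∈p
  ... | inj₂ y∈p∖x = p─q⊆p p ⁅ x ⁆ y∈p∖x
  from : p ⊆ ⁅ x ⁆ ∪ (p ∖ x)
  from {y} y∈p with y ∈? ⁅ x ⁆
  ... | yes y∈⁅x⁆ = x∈p∪q⁺ (inj₁ y∈⁅x⁆)
  ... | no  y∉⁅x⁆ = x∈p∪q⁺ (inj₂ (x∈p∧x∉q⇒x∈p─q y∈p y∉⁅x⁆))

-- Consequences of submodularity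

module Submodularity {c ℓ₁ ℓ₂} (𝔽 : ArchimedeanField c ℓ₁ ℓ₂) {n : ℕ} (f : Subset n → ArchimedeanField.Carrier 𝔽)
                     (nonNegative : Streaming.NonNegative 𝔽 f) (submodular : Streaming.Submodular 𝔽 f) where
  open ArchimedeanField 𝔽 hiding (zero)
    renaming (refl to ≈-refl; sym to ≈-sym; trans to ≈-trans; reflexive to ≈-reflexive)
  open Arithmetic 𝔽
  open ≤-Reasoning

  subadditive : ∀ S T → f (S ∪ T) ≤ f S + f T
  subadditive S T = ≤-trans (x≤x+y _ (nonNegative (S ∩ T))) (submodular S T)

  -- Submodularity for `⁅ x ⁆ ∪ S` and `T`: their union is `⁅ x ⁆ ∪ T`, and because `x` is outside
  -- `T` their intersection is `S`.
  diminishing-returns : ∀ {S T x} → S ⊆ T → x ∉ T → f (⁅ x ⁆ ∪ T) + f S ≤ f (⁅ x ⁆ ∪ S) + f T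
  diminishing-returns {S} {T} {x} S⊆T x∉T = begin
    f (⁅ x ⁆ ∪ T) + f S                        ≡⟨ cong₂ (λ A B → f A + f B) union intersection ⟨
    f ((⁅ x ⁆ ∪ S) ∪ T) + f ((⁅ x ⁆ ∪ S) ∩ T)  ≤⟨ submodular (⁅ x ⁆ ∪ S) T ⟩
    f (⁅ x ⁆ ∪ S) + f T                        ∎
    where
    union : (⁅ x ⁆ ∪ S) ∪ T ≡ ⁅ x ⁆ ∪ T
    union = trans (∪-assoc ⁅ x ⁆ S T) (cong (⁅ x ⁆ ∪_) (⊆-antisym
      (λ y∈ → [ S⊆T , (λ y∈T → y∈T) ] (x∈p∪q⁻ S T y∈)) (q⊆p∪q S T)))
    intersection : (⁅ x ⁆ ∪ S) ∩ T ≡ S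
    intersection = ⊆-antisym to (λ y∈S → x∈p∩q⁺ (q⊆p∪q ⁅ x ⁆ S y∈S , S⊆T y∈S))
      where
      to : (⁅ x ⁆ ∪ S) ∩ T ⊆ S
      to y∈ with y∈xS , y∈T ← x∈p∩q⁻ (⁅ x ⁆ ∪ S) T y∈ with x∈p∪q⁻ ⁅ x ⁆ S y∈xS
      ... | inj₂ y∈S = y∈S
      ... | inj₁ y∈⁅x⁆ rewrite x∈⁅y⁆⇒x≡y x y∈⁅x⁆ = contradiction y∈T x∉T

  -- κ f(x | S) ≤ t, with the subtraction moved to the other side.
  SmallGain : Carrier → Carrier → Subset n → Fin n → Set ℓ₂
  SmallGain κ t S x = κ * f (⁅ x ⁆ ∪ S) ≤ κ * f S + t

  -- Makes rejections permanent: a candidate set only grows afterwards, and an element still outside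
  -- it cannot gain in value.
  smallGain-⊆ : ∀ {κ t S T x} → 0# ≤ κ → S ⊆ T → x ∉ T → SmallGain κ t S x → SmallGain κ t T x
  smallGain-⊆ {κ} {t} {S} {T} {x} 0≤κ S⊆T x∉T small = +-cancelʳ-≤ (κ * f S) (begin
    κ * f (⁅ x ⁆ ∪ T) + κ * f S    ≈⟨ distribˡ κ _ _ ⟨
    κ * (f (⁅ x ⁆ ∪ T) + f S)      ≤⟨ *-monoˡ-≤ 0≤κ (diminishing-returns S⊆T x∉T) ⟩
    κ * (f (⁅ x ⁆ ∪ S) + f T)      ≈⟨ distribˡ κ _ _ ⟩
    κ * f (⁅ x ⁆ ∪ S) + κ * f T    ≤⟨ +-monoˡ-≤ _ small ⟩
    κ * f S + t + κ * f T          ≈⟨ solve 3 (λ a t b → a :+ t :+ b := b :+ t :+ a) ≈-refl (κ * f S) t (κ * f T) ⟩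
    κ * f T + t + κ * f S          ∎)

  -- Add the elements of `T` one by one; each costs at most `t`, since its gain over a larger set is
  -- no bigger than over `S`. Applied to the missed part of OPT over a candidate set, and to all of
  -- OPT over `⊥`.
  smallGains-∪ : ∀ {κ t S} → 0# ≤ κ → 0# ≤ t → ∀ m T → ∣ T ∣ ℕ.≤ m →
                 (∀ {x} → x ∈ T → SmallGain κ t S x) → κ * f (S ∪ T) ≤ κ * f S + fromℕ m * t
  smallGains-∪ {κ} {t} {S} 0≤κ 0≤t m T ∣T∣≤m small with nonempty? T
  ... | no T-empty = begin
    κ * f (S ∪ T)         ≡⟨ cong (λ U → κ * f (S ∪ U)) (Empty-unique T-empty) ⟩
    κ * f (S ∪ ⊥)         ≡⟨ cong (λ U → κ * f U) (∪-identityʳ S) ⟩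
    κ * f S               ≤⟨ x≤x+y _ (*-nonNeg (0≤fromℕ m) 0≤t) ⟩
    κ * f S + fromℕ m * t ∎
  smallGains-∪ {κ} {t} {S} 0≤κ 0≤t zero T ∣T∣≤0 small | yes (x , x∈T) =
    contradiction (ℕ.<-≤-trans (x∈p⇒∣p-x∣<∣p∣ x∈T) ∣T∣≤0) λ ()
  smallGains-∪ {κ} {t} {S} 0≤κ 0≤t (suc m) T ∣T∣≤m small | yes (x , x∈T) = begin
    κ * f (S ∪ T)                    ≡⟨ cong (λ U → κ * f U) split ⟩
    κ * f (⁅ x ⁆ ∪ (S ∪ (T ∖ x)))    ≤⟨ last ⟩
    κ * f (S ∪ (T ∖ x)) + t          ≤⟨ +-monoˡ-≤ t (smallGains-∪ 0≤κ 0≤t m (T ∖ x)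
                                          (ℕ.s≤s⁻¹ (ℕ.<-≤-trans (x∈p⇒∣p-x∣<∣p∣ x∈T) ∣T∣≤m))
                                          (small ∘ p─q⊆p T ⁅ x ⁆)) ⟩
    κ * f S + fromℕ m * t + t        ≈⟨ solve 3 (λ a m t → a :+ m :* t :+ t := a :+ (con 1 :+ m) :* t)
            ≈-refl (κ * f S) (fromℕ m) t ⟩
    κ * f S + (1# + fromℕ m) * t     ∎
    where
    split : S ∪ T ≡ ⁅ x ⁆ ∪ (S ∪ (T ∖ x))
    split = trans (cong (S ∪_) (sym (⁅x⁆∪[p∖x] x∈T))) (trans (sym (∪-assoc S ⁅ x ⁆ (T ∖ x)))
      (trans (cong (_∪ (T ∖ x)) (∪-comm S ⁅ x ⁆)) (∪-assoc ⁅ x ⁆ S (T ∖ x))))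
    last : SmallGain κ t (S ∪ (T ∖ x)) x
    -- An `x` that already lies in `S` has gain zero, a case outside the scope of diminishing
    -- returns.
    last with x ∈? (S ∪ (T ∖ x))
    ... | no  x∉ = smallGain-⊆ 0≤κ (p⊆p∪q (T ∖ x)) x∉ (small x∈T)
    ... | yes x∈ = begin
      κ * f (⁅ x ⁆ ∪ (S ∪ (T ∖ x)))  ≡⟨ cong (λ U → κ * f U) (⊆-antisym absorb (q⊆p∪q ⁅ x ⁆ _)) ⟩
      κ * f (S ∪ (T ∖ x))            ≤⟨ x≤x+y _ 0≤t ⟩
      κ * f (S ∪ (T ∖ x)) + t        ∎
      where
      absorb : ⁅ x ⁆ ∪ (S ∪ (T ∖ x)) ⊆ S ∪ (T ∖ x)
      absorb y∈ with x∈p∪q⁻ ⁅ x ⁆ _ y∈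
      ... | inj₂ y∈′ = y∈′
      ... | inj₁ y∈⁅x⁆ rewrite x∈⁅y⁆⇒x≡y x y∈⁅x⁆ = x∈

  -- Submodularity telescopes over disjoint sets, so on average S i hurts O by at most a 1/p fraction.
  disjoint-average : ∀ p (S : Fin p → Subset n) O {b} →
                     (∀ {i i′ x} → x ∈ S i → x ∈ S i′ → i ≡ i′) → (∀ i → f (O ∪ S i) ≤ b) →
                     fromℕ p * f O + f (O ∪ ⋃ᶠ S) ≤ f O + fromℕ p * b
  disjoint-average zero S O {b} disjoint bound = ≤-reflexive (begin-equality
    0# * f O + f (O ∪ ⊥)  ≡⟨ cong (λ U → 0# * f O + f U) (∪-identityʳ O) ⟩
    0# * f O + f O        ≈⟨ solve 2 (λ o b → con 0 :* o :+ o := o :+ con 0 :* b) ≈-refl (f O) b ⟩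
    f O + 0# * b          ∎)
  disjoint-average (suc p) S O {b} disjoint bound = begin
    (1# + fromℕ p) * f O + f (O ∪ (S zero ∪ U))
      ≈⟨ solve 3 (λ p o u → (con 1 :+ p) :* o :+ u := p :* o :+ (u :+ o)) ≈-refl (fromℕ p) (f O) _ ⟩
    -- The two values are those at the union and the intersection of `O ∪ S zero` and `O ∪ U`;
    -- disjointness makes the intersection `O`. Keeping the value at the full union on the left is
    -- what makes the sum telescope.
    fromℕ p * f O + (f (O ∪ (S zero ∪ U)) + f O)
      ≡⟨ cong₂ (λ A B → fromℕ p * f O + (f A + f B)) union intersection ⟨
    fromℕ p * f O + (f ((O ∪ S zero) ∪ (O ∪ U)) + f ((O ∪ S zero) ∩ (O ∪ U)))
      ≤⟨ +-monoʳ-≤ _ (≤-trans (submodular _ _) (+-monoˡ-≤ _ (bound zero))) ⟩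
    fromℕ p * f O + (b + f (O ∪ U))
      ≈⟨ solve 3 (λ o b u → o :+ (b :+ u) := (o :+ u) :+ b) ≈-refl _ b _ ⟩
    fromℕ p * f O + f (O ∪ U) + b
      ≤⟨ +-monoˡ-≤ b (disjoint-average p (S ∘ suc) O
           (λ x∈ x∈′ → Fin.suc-injective (disjoint x∈ x∈′)) (bound ∘ suc)) ⟩
    f O + fromℕ p * b + b
      ≈⟨ solve 3 (λ o p b → o :+ p :* b :+ b := o :+ (con 1 :+ p) :* b) ≈-refl (f O) (fromℕ p) b ⟩
    f O + (1# + fromℕ p) * b  ∎
    where
    U = ⋃ᶠ (S ∘ suc)
    union : (O ∪ S zero) ∪ (O ∪ U) ≡ O ∪ (S zero ∪ U)
    union = trans (∪-assoc O (S zero) (O ∪ U)) (trans (cong (O ∪_) (trans (sym (∪-assoc (S zero) O U))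
      (trans (cong (_∪ U) (∪-comm (S zero) O)) (∪-assoc O (S zero) U))))
      (trans (sym (∪-assoc O O (S zero ∪ U))) (cong (_∪ (S zero ∪ U)) (∪-idem O))))
    disjoint₀ : S zero ∩ U ≡ ⊥
    disjoint₀ = Empty-unique λ (x , x∈) → impossible (x∈p∩q⁻ (S zero) U x∈)
      where
      impossible : ∀ {x} → ¬ (x ∈ S zero × x ∈ U)
      impossible (x∈S₀ , x∈U) with i , x∈Sᵢ ← ∈⋃ᶠ⁻ (S ∘ suc) x∈U with () ← disjoint x∈S₀ x∈Sᵢ
    intersection : (O ∪ S zero) ∩ (O ∪ U) ≡ O
    intersection = trans (sym (∪-distribˡ-∩ O (S zero) U)) (trans (cong (O ∪_) disjoint₀) (∪-identityʳ O))

  unfilled-row : ∀ {k p τ a} (S : Fin p → Subset n) O → 1 ℕ.≤ k → 0# ≤ τ → ∣ O ∣ ℕ.≤ k →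
                 (∀ {i i′ x} → x ∈ S i → x ∈ S i′ → i ≡ i′) →
                 (∀ T → T ⊆ ⋃ᶠ S → ∣ T ∣ ℕ.≤ k → f T ≤ a) →
                 (∀ i → ∣ S i ∣ ℕ.≤ k) →
                 (∀ i x → x ∉ ⋃ᶠ S → SmallGain (fromℕ k) τ (S i) x) →
                 fromℕ p * f O ≤ f O + fromℕ p * (a + τ + a)
  unfilled-row {k} {p} {τ} {a} S O 1≤k 0≤τ ∣O∣≤k disjoint best size small = begin
    fromℕ p * f O                  ≤⟨ x≤x+y _ (nonNegative _) ⟩
    fromℕ p * f O + f (O ∪ ⋃ᶠ S)   ≤⟨ disjoint-average p S O disjoint bound ⟩
    f O + fromℕ p * (a + τ + a)    ∎
    where
    U = ⋃ᶠ S
    split : ∀ i → O ∪ S i ≡ (S i ∪ (O ∩ ∁ U)) ∪ (O ∩ U)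
    split i = trans (∪-comm O (S i)) (trans (cong (S i ∪_) (trans (sym (∩-identityʳ O)) (trans
      (cong (O ∩_) (sym (∪-inverseˡ U))) (∩-distribˡ-∪ O (∁ U) U)))) (sym (∪-assoc (S i) (O ∩ ∁ U) (O ∩ U))))
    bound : ∀ i → f (O ∪ S i) ≤ a + τ + a
    bound i = begin
      f (O ∪ S i)                           ≡⟨ cong f (split i) ⟩
      f ((S i ∪ (O ∩ ∁ U)) ∪ (O ∩ U))       ≤⟨ subadditive _ _ ⟩
      f (S i ∪ (O ∩ ∁ U)) + f (O ∩ U)
          ≤⟨ +-mono-≤ outside (best (O ∩ U) (p∩q⊆q O U) (ℕ.≤-trans (∣p∩q∣≤∣p∣ O U) ∣O∣≤k)) ⟩
      f (S i) + τ + a                       ≤⟨ +-monoˡ-≤ a (+-monoˡ-≤ τ (best (S i) (∈⋃ᶠ⁺ S i) (size i))) ⟩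
      a + τ + a                             ∎
      where
      outside : f (S i ∪ (O ∩ ∁ U)) ≤ f (S i) + τ
      -- At most `k` missed elements, each with `k` times its gain at most `τ`: the total is
      -- `k * τ`, and `k` cancels.
      outside = *-cancelˡ-≤ (0<fromℕ 1≤k) (begin
        fromℕ k * f (S i ∪ (O ∩ ∁ U))    ≤⟨ smallGains-∪ (0≤fromℕ k) 0≤τ k (O ∩ ∁ U)
                                              (ℕ.≤-trans (∣p∩q∣≤∣p∣ O (∁ U)) ∣O∣≤k)
                                              (λ {x} x∈ → small i x (x∈∁p⇒x∉p (p∩q⊆q O (∁ U) x∈))) ⟩
        fromℕ k * f (S i) + fromℕ k * τ  ≈⟨ distribˡ (fromℕ k) (f (S i)) τ ⟨
        fromℕ k * (f (S i) + τ)          ∎)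

-- Cardinalities, updates and shifts

∣p∪q∣≤∣p∣+∣q∣ : ∀ {n} (p q : Subset n) → ∣ p ∪ q ∣ ℕ.≤ ∣ p ∣ ℕ.+ ∣ q ∣
∣p∪q∣≤∣p∣+∣q∣ []          []          = ℕ.z≤n
∣p∪q∣≤∣p∣+∣q∣ (false ∷ p) (false ∷ q) = ∣p∪q∣≤∣p∣+∣q∣ p q
∣p∪q∣≤∣p∣+∣q∣ (false ∷ p) (true  ∷ q) = ℕ.≤-trans (ℕ.s≤s (∣p∪q∣≤∣p∣+∣q∣ p q)) (ℕ.≤-reflexive (sym (ℕ.+-suc ∣ p ∣ ∣ q ∣)))
∣p∪q∣≤∣p∣+∣q∣ (true  ∷ p) (b     ∷ q) = ℕ.s≤s (ℕ.≤-trans (∣p∪q∣≤∣p∣+∣q∣ p q) (ℕ.+-monoʳ-≤ ∣ p ∣ (∣p∣≤∣x∷p∣ b q)))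

∣⋃ᶠ∣≤ : ∀ {p n m} (S : Fin p → Subset n) → (∀ i → ∣ S i ∣ ℕ.≤ m) → ∣ ⋃ᶠ S ∣ ℕ.≤ p ℕ.* m
∣⋃ᶠ∣≤ {zero}  {n} S bound = ℕ.≤-reflexive (∣⊥∣≡0 n)
∣⋃ᶠ∣≤ {suc p} S bound =
  ℕ.≤-trans (∣p∪q∣≤∣p∣+∣q∣ (S zero) _) (ℕ.+-mono-≤ (bound zero) (∣⋃ᶠ∣≤ (S ∘ suc) (bound ∘ suc)))

∣p∣<n⇒Nonempty-∁ : ∀ {n} (p : Subset n) → ∣ p ∣ ℕ.< n → Nonempty (∁ p)
∣p∣<n⇒Nonempty-∁ {n} p ∣p∣<n with nonempty? (∁ p)
... | yes nonempty = nonempty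
... | no  empty    = contradiction (trans (sym (∣∁p∣≡n∸∣p∣ p)) (trans (cong ∣_∣ (Empty-unique empty)) (∣⊥∣≡0 n)))
                                   (ℕ.m>n⇒m∸n≢0 ∣p∣<n)

x∈p[x]≔ : ∀ {n} (p : Subset n) x → x ∈ p [ x ]≔ true
x∈p[x]≔ = Vec.[]≔-updates

p⊆p[x]≔ : ∀ {n} (p : Subset n) x → p ⊆ p [ x ]≔ true
p⊆p[x]≔ (_ ∷ p) zero    here       = here
p⊆p[x]≔ (_ ∷ p) zero    (there y∈) = there y∈
p⊆p[x]≔ (_ ∷ p) (suc x) here       = here
p⊆p[x]≔ (_ ∷ p) (suc x) (there y∈) = there (p⊆p[x]≔ p x y∈)

y∈p[x]≔⁻ : ∀ {n} (p : Subset n) x {y} → y ∈ p [ x ]≔ true → y ≡ x ⊎ y ∈ p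
y∈p[x]≔⁻ (_ ∷ p) zero    here       = inj₁ refl
y∈p[x]≔⁻ (_ ∷ p) zero    (there y∈) = inj₂ (there y∈)
y∈p[x]≔⁻ (_ ∷ p) (suc x) here       = inj₂ here
y∈p[x]≔⁻ (_ ∷ p) (suc x) (there y∈) = Sum.map (cong suc) there (y∈p[x]≔⁻ p x y∈)

∣p[x]≔∣ : ∀ {n} (p : Subset n) {x} → x ∉ p → ∣ p [ x ]≔ true ∣ ≡ suc ∣ p ∣
∣p[x]≔∣ (true  ∷ p) {zero}  x∉p = contradiction here x∉p
∣p[x]≔∣ (false ∷ p) {zero}  x∉p = refl
∣p[x]≔∣ (true  ∷ p) {suc x} x∉p = cong suc (∣p[x]≔∣ p (x∉p ∘ there))
∣p[x]≔∣ (false ∷ p) {suc x} x∉p = ∣p[x]≔∣ p (x∉p ∘ there)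

x∉p∖x : ∀ {n} (p : Subset n) x → x ∉ p ∖ x
x∉p∖x (_ ∷ p) zero    ()
x∉p∖x (_ ∷ p) (suc x) (there x∈) = x∉p∖x p x x∈

if-yes : ∀ {a b} {P : Set a} {A : Set b} {x y : A} (P? : Dec P) → P → (if does P? then x else y) ≡ x
if-yes P? p = cong (if_then _ else _) (dec-true P? p)

if-no : ∀ {a b} {P : Set a} {A : Set b} {x y : A} (P? : Dec P) → ¬ P → (if does P? then x else y) ≡ y
if-no P? ¬p = cong (if_then _ else _) (dec-false P? ¬p)

-- Replacing oversized masks by `⊥` lets the search run through all masks while only ever proposing
-- feasible ones.
capped : ∀ {n} → ℕ → Subset n → Subset n
capped k S = if does (∣ S ∣ ℕ.≤? k) then S else ⊥

capped-small : ∀ {n k} (S : Subset n) → ∣ S ∣ ℕ.≤ k → capped k S ≡ S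
capped-small {k = k} S small = if-yes (∣ S ∣ ℕ.≤? k) small

∣capped∣≤ : ∀ {n} k (S : Subset n) → ∣ capped k S ∣ ℕ.≤ k
∣capped∣≤ {n} k S with ∣ S ∣ ℕ.≤? k
... | yes small = subst (λ T → ∣ T ∣ ℕ.≤ k) (sym (capped-small S small)) small
... | no  large = subst (λ T → ∣ T ∣ ℕ.≤ k) (sym (if-no (∣ S ∣ ℕ.≤? k) large))
                    (ℕ.≤-trans (ℕ.≤-reflexive (∣⊥∣≡0 n)) ℕ.z≤n)

-- Moves the window up by one guess: the lowest row is dropped, and `y` becomes the row of the new
-- highest guess.
push : ∀ {A : Set} {n} → A → Vec A n → Vec A n
push y []       = []
push y (x ∷ xs) = xs ∷ʳ y

lookup-push : ∀ {A : Set} {n} (y : A) (xs : Vec A n) j →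
              (suc (toℕ j) ≡ n × lookup (push y xs) j ≡ y) ⊎
              (∃[ j′ ] toℕ j′ ≡ suc (toℕ j) × lookup (push y xs) j ≡ lookup xs j′)
lookup-push y (x ∷ [])      zero    = inj₁ (refl , refl)
lookup-push y (x ∷ x′ ∷ xs) zero    = inj₂ (suc zero , refl , refl)
lookup-push y (x ∷ x′ ∷ xs) (suc j) with lookup-push y (x′ ∷ xs) j
... | inj₁ (last , eq)    = inj₁ (cong suc last , eq)
... | inj₂ (j′ , eq , eq′) = inj₂ (suc j′ , cong suc eq , eq′)

-- Sets of slots and the elements in them

module Contents {c ℓ₁ ℓ₂} (𝔽 : ArchimedeanField c ℓ₁ ℓ₂) where
  open Streaming 𝔽 using (contents)

  ∈contents⁺ : ∀ {n s} (σ : Vec (Fin n) s) {m y} → y ∈ m → lookup σ y ∈ contents σ m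
  ∈contents⁺ (x ∷ σ) {true  ∷ m} here        = x∈p∪q⁺ (inj₁ (x∈⁅x⁆ x))
  ∈contents⁺ (x ∷ σ) {true  ∷ m} (there y∈m) = x∈p∪q⁺ (inj₂ (∈contents⁺ σ y∈m))
  ∈contents⁺ (x ∷ σ) {false ∷ m} (there y∈m) = ∈contents⁺ σ y∈m

  ∈contents⁻ : ∀ {n s} (σ : Vec (Fin n) s) m {x} → x ∈ contents σ m → ∃[ y ] y ∈ m × lookup σ y ≡ x
  ∈contents⁻ []      []          x∈ = contradiction x∈ ∉⊥
  ∈contents⁻ (u ∷ σ) (true ∷ m)  x∈ with x∈p∪q⁻ ⁅ u ⁆ _ x∈
  ... | inj₁ x∈⁅u⁆ = zero , here , sym (x∈⁅y⁆⇒x≡y u x∈⁅u⁆)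
  ... | inj₂ x∈′ with y , y∈m , eq ← ∈contents⁻ σ m x∈′ = suc y , there y∈m , eq
  ∈contents⁻ (u ∷ σ) (false ∷ m) x∈ with y , y∈m , eq ← ∈contents⁻ σ m x∈ = suc y , there y∈m , eq

  contents-⊥ : ∀ {n s} (σ : Vec (Fin n) s) → contents σ ⊥ ≡ ⊥
  contents-⊥ []      = refl
  contents-⊥ (x ∷ σ) = contents-⊥ σ

  contents-⁅⁆ : ∀ {n s} (σ : Vec (Fin n) s) z → contents σ ⁅ z ⁆ ≡ ⁅ lookup σ z ⁆
  contents-⁅⁆ (x ∷ σ) zero    = trans (cong (⁅ x ⁆ ∪_) (contents-⊥ σ)) (∪-identityʳ ⁅ x ⁆)
  contents-⁅⁆ (x ∷ σ) (suc z) = contents-⁅⁆ σ z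

  contents-⊆ : ∀ {n s} (σ : Vec (Fin n) s) {m m′} → m ⊆ m′ → contents σ m ⊆ contents σ m′
  contents-⊆ σ {m} m⊆m′ x∈ with y , y∈m , refl ← ∈contents⁻ σ m x∈ = ∈contents⁺ σ (m⊆m′ y∈m)

  contents-insert : ∀ {n s} (σ : Vec (Fin n) s) m z → contents σ (m [ z ]≔ true) ≡ ⁅ lookup σ z ⁆ ∪ contents σ m
  contents-insert σ m z = ⊆-antisym to from
    where
    to : contents σ (m [ z ]≔ true) ⊆ ⁅ lookup σ z ⁆ ∪ contents σ m
    to x∈ with y , y∈ , refl ← ∈contents⁻ σ (m [ z ]≔ true) x∈ with y∈p[x]≔⁻ m z y∈
    ... | inj₁ refl = x∈p∪q⁺ (inj₁ (x∈⁅x⁆ _))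
    ... | inj₂ y∈m  = x∈p∪q⁺ (inj₂ (∈contents⁺ σ y∈m))
    from : ⁅ lookup σ z ⁆ ∪ contents σ m ⊆ contents σ (m [ z ]≔ true)
    from x∈ with x∈p∪q⁻ ⁅ lookup σ z ⁆ _ x∈
    ... | inj₁ x∈⁅⁆ rewrite x∈⁅y⁆⇒x≡y _ x∈⁅⁆ = ∈contents⁺ σ (x∈p[x]≔ m z)
    ... | inj₂ x∈σ = contents-⊆ σ (p⊆p[x]≔ m z) x∈σ

  contents-overwrite : ∀ {n s} (σ : Vec (Fin n) s) {m z} x → z ∉ m → contents (σ [ z ]≔ x) m ≡ contents σ m
  contents-overwrite (u ∷ σ) {true  ∷ m} {zero}  x z∉m = contradiction here z∉m
  contents-overwrite (u ∷ σ) {false ∷ m} {zero}  x z∉m = refl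
  contents-overwrite (u ∷ σ) {true  ∷ m} {suc z} x z∉m = cong (⁅ u ⁆ ∪_) (contents-overwrite σ x (z∉m ∘ there))
  contents-overwrite (u ∷ σ) {false ∷ m} {suc z} x z∉m = contents-overwrite σ x (z∉m ∘ there)

  ∣contents∣≤ : ∀ {n s} (σ : Vec (Fin n) s) m → ∣ contents σ m ∣ ℕ.≤ ∣ m ∣
  ∣contents∣≤ {n} []      []          = ℕ.≤-reflexive (∣⊥∣≡0 n)
  ∣contents∣≤     (x ∷ σ) (true  ∷ m) = ℕ.≤-trans (∣p∪q∣≤∣p∣+∣q∣ ⁅ x ⁆ (contents σ m))
    (ℕ.+-mono-≤ (ℕ.≤-reflexive (∣⁅x⁆∣≡1 x)) (∣contents∣≤ σ m))
  ∣contents∣≤     (x ∷ σ) (false ∷ m) = ∣contents∣≤ σ m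

  covers-tail : ∀ {n s} {σ : Vec (Fin n) s} {u T} → u ∉ T → (∀ {x} → x ∈ T → ∃[ y ] lookup (u ∷ σ) y ≡ x) →
                ∀ {x} → x ∈ T → ∃[ y ] lookup σ y ≡ x
  covers-tail u∉T T⊆uσ x∈T with T⊆uσ x∈T
  ... | zero  , refl = contradiction x∈T u∉T
  ... | suc y , eq   = y , eq

  -- Several slots may hold the same element. Choosing the first slot for each element and deleting
  -- it from `T` keeps the mask no larger than `T`, which matters because the search limits the size
  -- of masks.
  mask : ∀ {n s} (σ : Vec (Fin n) s) T → (∀ {x} → x ∈ T → ∃[ y ] lookup σ y ≡ x) →
         ∃[ m ] contents σ m ≡ T × ∣ m ∣ ℕ.≤ ∣ T ∣
  mask []      T T⊆σ = [] , sym (Empty-unique λ (x , x∈T) → Fin.¬Fin0 (proj₁ (T⊆σ x∈T))) , ℕ.z≤n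
  mask (u ∷ σ) T T⊆σ with u ∈? T
  ... | yes u∈T with m , eq , ∣m∣≤ ← mask σ (T ∖ u) (covers-tail (x∉p∖x T u) (T⊆σ ∘ p─q⊆p T ⁅ u ⁆)) =
    true ∷ m , trans (cong (⁅ u ⁆ ∪_) eq) (⁅x⁆∪[p∖x] u∈T) , ℕ.≤-trans (ℕ.s≤s ∣m∣≤) (x∈p⇒∣p-x∣<∣p∣ u∈T)
  ... | no u∉T with m , eq , ∣m∣≤ ← mask σ T (covers-tail u∉T T⊆σ) = false ∷ m , eq , ∣m∣≤

-- The machine and the size of its memory

-- The left-hand side is the form to which the length bound of `control-code` unfolds, for masks
-- `m`, slots `b`, set indices `g` and subsets or cursors `s`. Its summands number 18 = 1 + 1 + 3 +
-- 3 + 10.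
length-layout : ∀ m b g s {Z} → m ℕ.≤ Z → b ℕ.≤ Z → g ℕ.≤ Z → s ℕ.≤ Z → 1 ℕ.≤ Z →
  suc (1 ℕ.+ suc (m ℕ.+ (b ℕ.+ suc (suc (suc (suc g ℕ.+ suc (g ℕ.+ g))))) ℕ.+ (suc (suc s ℕ.+ s) ℕ.+ s))) ℕ.≤ 18 ℕ.* Z
length-layout m b g s {Z} m≤ b≤ g≤ s≤ 1≤ = begin
  suc (1 ℕ.+ suc (m ℕ.+ (b ℕ.+ suc (suc (suc (suc g ℕ.+ suc (g ℕ.+ g))))) ℕ.+ (suc (suc s ℕ.+ s) ℕ.+ s)))
    ≡⟨ expand m b g s ⟩
  m ℕ.+ b ℕ.+ 3 ℕ.* g ℕ.+ 3 ℕ.* s ℕ.+ 10 ℕ.* 1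
    ≤⟨ ℕ.+-mono-≤ (ℕ.+-mono-≤ (ℕ.+-mono-≤ (ℕ.+-mono-≤ m≤ b≤) (ℕ.*-monoʳ-≤ 3 g≤)) (ℕ.*-monoʳ-≤ 3 s≤)) (ℕ.*-monoʳ-≤ 10 1≤) ⟩
  Z ℕ.+ Z ℕ.+ 3 ℕ.* Z ℕ.+ 3 ℕ.* Z ℕ.+ 10 ℕ.* Z
    ≡⟨ collect Z ⟩
  18 ℕ.* Z  ∎
  where
  open ℕ.≤-Reasoning
  expand : ∀ m b g s → suc (1 ℕ.+ suc (m ℕ.+ (b ℕ.+ suc (suc (suc (suc g ℕ.+ suc (g ℕ.+ g))))) ℕ.+ (suc (suc s ℕ.+ s) ℕ.+ s)))
                     ≡ m ℕ.+ b ℕ.+ 3 ℕ.* g ℕ.+ 3 ℕ.* s ℕ.+ 10 ℕ.* 1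
  expand = solve-∀
  collect : ∀ Z → Z ℕ.+ Z ℕ.+ 3 ℕ.* Z ℕ.+ 3 ℕ.* Z ℕ.+ 10 ℕ.* Z ≡ 18 ℕ.* Z
  collect = solve-∀

-- W thresholds base · ρ^j, and for each of them p disjoint candidate solutions,
-- kept as sets of positions of an element memory with B slots.
module Sieve {c ℓ₁ ℓ₂} (𝔽 : ArchimedeanField c ℓ₁ ℓ₂) (k W p : ℕ) (ρ : ArchimedeanField.Carrier 𝔽) where
  open ArchimedeanField 𝔽 hiding (zero; _≤_)
    renaming (refl to ≈-refl; sym to ≈-sym; trans to ≈-trans; reflexive to ≈-reflexive)
  open Streaming 𝔽
  open Arithmetic 𝔽 using (_^_)

  G B : ℕ
  G = W ℕ.* p
  -- One slot more than the candidates can occupy.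
  B = suc (G ℕ.* k)

  -- `base * R` is the first guess above the window.
  R : Carrier
  R = ρ ^ W

  Row Masks : Set
  Row   = Vec (Subset B) p
  Masks = Vec Row W

  emptyRow : Row
  emptyRow = replicate p ⊥

  emptyMasks : Masks
  emptyMasks = replicate W emptyRow

  insertRow : Row → Fin p → Fin B → Row
  insertRow row i z = updateAt row i (_[ z ]≔ true)

  insert : Masks → Fin W → Fin p → Fin B → Masks
  insert M j i z = updateAt M j (λ row → insertRow row i z)

  used : Masks → Subset B
  used M = ⋃ᶠ (λ j → ⋃ᶠ (λ i → lookup (lookup M j) i))

  -- The second case never arises, as the masks have at most G * k < B elements in total.
  free : Masks → Fin B
  free M with nonempty? (∁ (used M))
  ... | yes (z , _) = z
  ... | no  _       = zero

  -- The first condition keeps the sets of a row disjoint. It is a test on slots, as the machine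
  -- cannot compare elements.
  Eligible : Row → Fin p → Fin B → Set
  Eligible row i z = (∀ i′ → z ∉ lookup row i′) × ∣ lookup row i ∣ ℕ.< k

  eligible? : ∀ row i z → Dec (Eligible row i z)
  eligible? row i z = Fin.all? (λ i′ → ¬? (z ∈? lookup row i′)) ×-dec (∣ lookup row i ∣ ℕ.<? k)

  candidate : Fin (2 ℕ.^ B) → Subset B
  candidate t = capped k (unrank B t)

  threshold : Fin G → Fin W
  threshold g = proj₁ (remQuot {W} p g)

  level : Fin G → Fin p
  level g = proj₂ (remQuot {W} p g)

  -- The Fin (suc _) arguments count down.
  data Control : Set where
    init void         : Control
    arrived scaling   : Masks → Fin B → Control
    offering          : Masks → Fin B → Fin (suc G) → Control
    queried₁ queried₂ : Masks → Fin B → Fin G → Control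
    searching         : Fin (suc (2 ℕ.^ B)) → Subset B → Control
    searched          : Fin (2 ℕ.^ B) → Subset B → Control

  numbers : Control → ℕ
  numbers init             = 0
  numbers void             = 0
  numbers (arrived _ _)    = 1
  numbers (scaling _ _)    = 2
  numbers (offering _ _ _) = 1
  numbers (queried₁ _ _ _) = 2
  numbers (queried₂ _ _ _) = 3
  numbers (searching _ _)  = 1
  numbers (searched _ _)   = 2

  elements : Control → ℕ
  elements init = 0
  elements void = 0
  elements _    = B

  v₀ : ∀ {r} → Expr (suc r)
  v₀ = var zero

  v₁ : ∀ {r} → Expr (suc (suc r))
  v₁ = var (suc zero)

  v₂ : ∀ {r} → Expr (suc (suc (suc r)))
  v₂ = var (suc (suc zero))

  -- From `arrived` to `queried₂` the last number is `base`, preceded by the oracle answers: the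
  -- singleton value in `scaling`, the value of the current set in `queried₁`, and the values with
  -- and without the new element in `queried₂`. In `searching` and `searched` the last number
  -- belongs to the best mask so far.
  program : (q : Control) → DecisionTree (numbers q) (Action numbers elements (numbers q) (elements q))
  -- There is no blank token, so the first arrival fills every slot. The base 0 is a safe lower
  -- bound for f(OPT)/3.
  program init = leaf (read (goto (arrived emptyMasks zero) (con 0# ∷ []) (replicate B zero)) (goto void [] []))
  program void = leaf (output [])
  program (arrived M z) = leaf (query ⁅ z ⁆ (goto (scaling M z) (v₀ ∷ v₁ ∷ []) (allFin B)))
  program (scaling M z) =
    if con (fromℕ k) ⊗ v₀ ≤ (v₁ ⊗ con R)
    then leaf (move (goto (offering M z (Fin.fromℕ G)) (v₁ ∷ []) (allFin B)))
    -- A third of the singleton value is at or above the end of the window: every row is then out of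
    -- range, and the window restarts at that value.
    else if con (fromℕ 3) ⊗ (v₁ ⊗ con R) ≤ v₀
    then leaf (move (goto (offering emptyMasks z (Fin.fromℕ G)) ((v₀ ⊗ con (fromℕ 3 ⁻¹)) ∷ []) (allFin B)))
    else leaf (move (goto (scaling (push emptyRow M) z) (v₀ ∷ (v₁ ⊗ con ρ) ∷ []) (allFin B)))
  program (offering M z zero) =
    leaf (read (goto (arrived M (free M)) (v₀ ∷ []) (Vec.map suc (allFin B) [ free M ]≔ zero))
               -- Only a lower bound for the value of the best mask is maintained, and 0 is one for
               -- `⊥`.
               (goto (searching (Fin.fromℕ (2 ℕ.^ B)) ⊥) (con 0# ∷ []) (allFin B)))
  program (offering M z (suc g)) = leaf (
    if does (eligible? (lookup M (threshold g)) (level g) z)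
    then query (lookup (lookup M (threshold g)) (level g)) (goto (queried₁ M z g) (v₀ ∷ v₁ ∷ []) (allFin B))
    else move (goto (offering M z (inject₁ g)) (v₀ ∷ []) (allFin B)))
  program (queried₁ M z g) =
    leaf (query (lookup (lookup M (threshold g)) (level g) [ z ]≔ true)
                (goto (queried₂ M z g) (v₀ ∷ v₁ ∷ v₂ ∷ []) (allFin B)))
  program (queried₂ M z g) =
    if con (fromℕ k) ⊗ v₀ ≤ ((con (fromℕ k) ⊗ v₁) ⊕ (v₂ ⊗ con (ρ ^ toℕ (threshold g))))
    then leaf (move (goto (offering M z (inject₁ g)) (v₂ ∷ []) (allFin B)))
    else leaf (move (goto (offering (insert M (threshold g) (level g) z) z (inject₁ g)) (v₂ ∷ []) (allFin B)))
  program (searching zero best) = leaf (output best)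
  program (searching (suc t) best) =
    leaf (query (candidate t) (goto (searched t best) (v₀ ∷ v₁ ∷ []) (allFin B)))
  program (searched t best) =
    if v₀ ≤ v₁
    then leaf (move (goto (searching (inject₁ t) best) (v₁ ∷ []) (allFin B)))
    else leaf (move (goto (searching (inject₁ t) (candidate t)) (v₀ ∷ []) (allFin B)))

  masks-code : Code Masks
  masks-code = vec-code (vec-code (subset-code B) p) W

  Sum : Set
  Sum = (⊤ ⊎ ⊤)
      ⊎ (Masks × Fin B × (⊤ ⊎ ⊤ ⊎ Fin (suc G) ⊎ Fin G ⊎ Fin G))
      ⊎ ((Fin (suc (2 ℕ.^ B)) ⊎ Fin (2 ℕ.^ B)) × Subset B)

  toSum : Control → Sum
  toSum init             = inj₁ (inj₁ tt)
  toSum void             = inj₁ (inj₂ tt)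
  toSum (arrived M z)    = inj₂ (inj₁ (M , z , inj₁ tt))
  toSum (scaling M z)    = inj₂ (inj₁ (M , z , inj₂ (inj₁ tt)))
  toSum (offering M z t) = inj₂ (inj₁ (M , z , inj₂ (inj₂ (inj₁ t))))
  toSum (queried₁ M z g) = inj₂ (inj₁ (M , z , inj₂ (inj₂ (inj₂ (inj₁ g)))))
  toSum (queried₂ M z g) = inj₂ (inj₁ (M , z , inj₂ (inj₂ (inj₂ (inj₂ g)))))
  toSum (searching t S)  = inj₂ (inj₂ (inj₁ t , S))
  toSum (searched t S)   = inj₂ (inj₂ (inj₂ t , S))

  fromSum : Sum → Control
  fromSum (inj₁ (inj₁ tt))                                     = init
  fromSum (inj₁ (inj₂ tt))                                     = void
  fromSum (inj₂ (inj₁ (M , z , inj₁ tt)))                      = arrived M z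
  fromSum (inj₂ (inj₁ (M , z , inj₂ (inj₁ tt))))               = scaling M z
  fromSum (inj₂ (inj₁ (M , z , inj₂ (inj₂ (inj₁ t)))))         = offering M z t
  fromSum (inj₂ (inj₁ (M , z , inj₂ (inj₂ (inj₂ (inj₁ g))))))  = queried₁ M z g
  fromSum (inj₂ (inj₁ (M , z , inj₂ (inj₂ (inj₂ (inj₂ g))))))  = queried₂ M z g
  fromSum (inj₂ (inj₂ (inj₁ t , S)))                           = searching t S
  fromSum (inj₂ (inj₂ (inj₂ t , S)))                           = searched t S

  fromSum∘toSum : ∀ q → fromSum (toSum q) ≡ q
  fromSum∘toSum init             = refl
  fromSum∘toSum void             = refl
  fromSum∘toSum (arrived _ _)    = refl
  fromSum∘toSum (scaling _ _)    = refl
  fromSum∘toSum (offering _ _ _) = refl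
  fromSum∘toSum (queried₁ _ _ _) = refl
  fromSum∘toSum (queried₂ _ _ _) = refl
  fromSum∘toSum (searching _ _)  = refl
  fromSum∘toSum (searched _ _)   = refl

  control-code : Code Control
  control-code = retract-code toSum fromSum fromSum∘toSum
    ((⊤-code ⊎-code ⊤-code) ⊎-code
     (masks-code ×-code fin-code B ×-code
       (⊤-code ⊎-code ⊤-code ⊎-code fin-code (suc G) ⊎-code fin-code G ⊎-code fin-code G)) ⊎-code
     ((suc-code (cursor-code B) ⊎-code cursor-code B) ×-code subset-code B))

  machine : Machine
  machine = record
    { Control          = Control
    ; encode           = Code.encode control-code
    ; encode-injective = Code.injective control-code
    ; numbers          = numbers
    ; elements         = elements
    ; start            = goto init [] []
    ; program          = program
    }

  elements≤B : ∀ q → elements q ℕ.≤ B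
  elements≤B init             = ℕ.z≤n
  elements≤B void             = ℕ.z≤n
  elements≤B (arrived _ _)    = ℕ.≤-refl
  elements≤B (scaling _ _)    = ℕ.≤-refl
  elements≤B (offering _ _ _) = ℕ.≤-refl
  elements≤B (queried₁ _ _ _) = ℕ.≤-refl
  elements≤B (queried₂ _ _ _) = ℕ.≤-refl
  elements≤B (searching _ _)  = ℕ.≤-refl
  elements≤B (searched _ _)   = ℕ.≤-refl

  numbers≤3 : ∀ q → numbers q ℕ.≤ 3
  numbers≤3 init             = ℕ.z≤n
  numbers≤3 void             = ℕ.z≤n
  numbers≤3 (arrived _ _)    = ℕ.s≤s ℕ.z≤n
  numbers≤3 (scaling _ _)    = ℕ.s≤s (ℕ.s≤s ℕ.z≤n)
  numbers≤3 (offering _ _ _) = ℕ.s≤s ℕ.z≤n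
  numbers≤3 (queried₁ _ _ _) = ℕ.s≤s (ℕ.s≤s ℕ.z≤n)
  numbers≤3 (queried₂ _ _ _) = ℕ.≤-refl
  numbers≤3 (searching _ _)  = ℕ.s≤s ℕ.z≤n
  numbers≤3 (searched _ _)   = ℕ.s≤s (ℕ.s≤s ℕ.z≤n)

  control-length : Code.maxLength control-code ℕ.≤ 18 ℕ.* (suc G ℕ.* B)
  control-length = length-layout
    (Code.maxLength masks-code) (Code.maxLength (fin-code B))
    (Code.maxLength (fin-code G)) (Code.maxLength (subset-code B))
    (ℕ.≤-trans (ℕ.≤-reflexive masks-length) (ℕ.m≤n+m (G ℕ.* B) B))
    (ℕ.≤-trans (ℕ.≤-reflexive (fin-maxLength B)) B≤)
    (ℕ.≤-trans (ℕ.≤-reflexive (fin-maxLength G)) (ℕ.≤-trans (ℕ.n≤1+n G) (ℕ.m≤m*n (suc G) B)))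
    (ℕ.≤-trans (ℕ.≤-reflexive subset-length) B≤)
    (ℕ.*-mono-≤ {1} {suc G} {1} {B} (ℕ.s≤s ℕ.z≤n) (ℕ.s≤s ℕ.z≤n))
    where
    B≤ : B ℕ.≤ suc G ℕ.* B
    B≤ = ℕ.m≤m+n B (G ℕ.* B)
    subset-length : Code.maxLength (subset-code B) ≡ B
    subset-length = trans (vec-maxLength bool-code B) (ℕ.*-identityʳ B)
    masks-length : Code.maxLength masks-code ≡ G ℕ.* B
    masks-length = trans (vec-maxLength (vec-code (subset-code B) p) W)
      (trans (cong (W ℕ.*_) (trans (vec-maxLength (subset-code B) p) (cong (p ℕ.*_) subset-length))) (sym (ℕ.*-assoc W p B)))

  memory≤ : ∀ q l → List.length (Code.encode control-code q) ℕ.+ numbers q ℕ.+ elements q ℕ.* l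
                    ℕ.≤ 21 ℕ.* (suc G ℕ.* B) ℕ.+ B ℕ.* l
  memory≤ q l = ℕ.+-mono-≤ (ℕ.≤-trans (ℕ.+-mono-≤ (ℕ.≤-trans (Code.bounded control-code q) control-length) 3≤)
      (ℕ.≤-reflexive (sym (ℕ.*-distribʳ-+ (suc G ℕ.* B) 18 3))))
    (ℕ.*-monoˡ-≤ l (elements≤B q))
    where
    3≤ : numbers q ℕ.≤ 3 ℕ.* (suc G ℕ.* B)
    3≤ = ℕ.≤-trans (numbers≤3 q) (ℕ.*-mono-≤ {3} {3} {1} {suc G ℕ.* B} ℕ.≤-refl (ℕ.s≤s ℕ.z≤n))

-- Invariants of the candidate sets

module Correctness {c ℓ₁ ℓ₂} (𝔽 : ArchimedeanField c ℓ₁ ℓ₂) (k W p : ℕ) (ρ : ArchimedeanField.Carrier 𝔽)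
                   {n : ℕ} (f : Subset n → ArchimedeanField.Carrier 𝔽)
                   (nonNegative : Streaming.NonNegative 𝔽 f) (submodular : Streaming.Submodular 𝔽 f) where
  open ArchimedeanField 𝔽 hiding (zero)
    renaming (refl to ≈-refl; sym to ≈-sym; trans to ≈-trans; reflexive to ≈-reflexive)
  open Streaming 𝔽
  open Arithmetic 𝔽
  open Submodularity 𝔽 f nonNegative submodular
  open Contents 𝔽
  open Sieve 𝔽 k W p ρ
  open Execution machine f
  open ≤-Reasoning

  -- Why set `i` lacks nothing from `x`: it is kept somewhere in the row, set `i` is full, or `x`
  -- gains too little. The first case ranges over all sets, because disjointness bars an element
  -- kept in one set from the others.
  Handled : Vec (Fin n) B → Carrier → Row → Fin p → Fin n → Set ℓ₂
  Handled σ τ row i x = (∃[ i′ ] x ∈ contents σ (lookup row i′))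
                      ⊎ k ℕ.≤ ∣ lookup row i ∣
                      ⊎ SmallGain (fromℕ k) τ (contents σ (lookup row i)) x

  -- `value` credits τ/k to each occupied slot, so a full set is worth at least τ. `Allowed` limits
  -- the slots in use: those with seen elements between arrivals, and also the current slot while
  -- its element is offered.
  record RowInvariant (σ : Vec (Fin n) B) (seen : List (Fin n)) (Allowed : Fin B → Set)
                      (τ : Carrier) (row : Row) : Set ℓ₂ where
    field
      allowed  : ∀ i {y} → y ∈ lookup row i → Allowed y
      size     : ∀ i → ∣ lookup row i ∣ ℕ.≤ k
      value    : ∀ i → fromℕ ∣ lookup row i ∣ * τ ≤ fromℕ k * f (contents σ (lookup row i))
      disjoint : ∀ {i i′ x} → x ∈ contents σ (lookup row i) → x ∈ contents σ (lookup row i′) → i ≡ i′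
      handled  : ∀ i {x} → x ∈ₗ seen → Handled σ τ row i x

  -- `base-low` keeps the window from starting above f(OPT)/3. `base-high` says that nothing seen so
  -- far could have joined a set of the guess `base * R` or higher, which permits shifting upwards.
  record Invariant (σ : Vec (Fin n) B) (seen : List (Fin n)) (Allowed : Fin B → Set)
                   (base : Carrier) (M : Masks) : Set ℓ₂ where
    field
      base-nonNeg : 0# ≤ base
      base-low    : ∀ O → IsOptimal f k O → fromℕ 3 * base ≤ f O
      base-high   : ∀ {x} → x ∈ₗ seen → fromℕ k * f ⁅ x ⁆ ≤ base * R
      rows        : ∀ j → RowInvariant σ seen Allowed (base * ρ ^ toℕ j) (lookup M j)

  handled-≤ : ∀ {σ τ τ′ row i x} → τ ≤ τ′ → Handled σ τ row i x → Handled σ τ′ row i x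
  handled-≤ τ≤τ′ (inj₁ member)       = inj₁ member
  handled-≤ τ≤τ′ (inj₂ (inj₁ full))  = inj₂ (inj₁ full)
  handled-≤ τ≤τ′ (inj₂ (inj₂ small)) = inj₂ (inj₂ (≤-trans small (+-monoʳ-≤ _ τ≤τ′)))

  row-resp-≈ : ∀ {σ seen Allowed τ τ′ row} → τ ≈ τ′ →
               RowInvariant σ seen Allowed τ row → RowInvariant σ seen Allowed τ′ row
  row-resp-≈ {σ} {row = row} τ≈τ′ inv = record
    { allowed  = allowed
    ; size     = size
    ; value    = λ i → ≤-trans (≤-reflexive (*-congˡ (≈-sym τ≈τ′))) (value i)
    ; disjoint = disjoint
    ; handled  = λ i x∈ → handled-≤ {σ} {row = row} (≤-reflexive τ≈τ′) (handled i x∈)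
    }
    where open RowInvariant inv

  emptyRow-contents : ∀ (σ : Vec (Fin n) B) i → contents σ (lookup emptyRow i) ≡ ⊥
  emptyRow-contents σ i = trans (cong (contents σ) (Vec.lookup-replicate i ⊥)) (contents-⊥ σ)

  ∣emptyRow∣ : ∀ i → ∣ lookup emptyRow i ∣ ≡ 0
  ∣emptyRow∣ i = trans (cong ∣_∣ (Vec.lookup-replicate i ⊥)) (∣⊥∣≡0 B)

  -- A guess that enters the window late behaves as if it had been there from the start: every seen
  -- element would have been rejected by the empty sets.
  row-empty : ∀ {σ seen Allowed τ} → (∀ {x} → x ∈ₗ seen → fromℕ k * f ⁅ x ⁆ ≤ τ) →
              RowInvariant σ seen Allowed τ emptyRow
  row-empty {σ} {seen} {τ = τ} high = record
    { allowed  = λ i y∈ → contradiction (subst (_ ∈_) (Vec.lookup-replicate i ⊥) y∈) ∉⊥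
    ; size     = λ i → subst (ℕ._≤ k) (sym (∣emptyRow∣ i)) ℕ.z≤n
    ; value    = λ i → begin
        fromℕ ∣ lookup emptyRow i ∣ * τ              ≡⟨ cong (λ m → fromℕ m * τ) (∣emptyRow∣ i) ⟩
        0# * τ                                       ≈⟨ zeroˡ τ ⟩
        0#                                           ≤⟨ *-nonNeg (0≤fromℕ k) (nonNegative _) ⟩
        fromℕ k * f (contents σ (lookup emptyRow i)) ∎
    ; disjoint = λ {i} x∈ _ → contradiction (subst (_ ∈_) (emptyRow-contents σ i) x∈) ∉⊥
    ; handled  = λ i {x} x∈ → inj₂ (inj₂ (subst (λ S → SmallGain (fromℕ k) τ S x) (sym (emptyRow-contents σ i)) (begin
        fromℕ k * f (⁅ x ⁆ ∪ ⊥)  ≡⟨ cong (λ S → fromℕ k * f S) (∪-identityʳ ⁅ x ⁆) ⟩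
        fromℕ k * f ⁅ x ⁆        ≤⟨ high x∈ ⟩
        τ                        ≤⟨ x≤x+y τ (*-nonNeg (0≤fromℕ k) (nonNegative ⊥)) ⟩
        τ + fromℕ k * f ⊥        ≈⟨ +-comm _ _ ⟩
        fromℕ k * f ⊥ + τ        ∎)))
    }

  -- Slots outside all masks of the row can be reused, since neither the contents of its sets nor
  -- their values depend on them.
  row-overwrite : ∀ {σ seen Allowed Allowed′ τ row z} x → (∀ i → z ∉ lookup row i) →
                  (∀ {y} → y ≢ z → Allowed y → Allowed′ y) →
                  RowInvariant σ seen Allowed τ row → RowInvariant (σ [ z ]≔ x) seen Allowed′ τ row
  row-overwrite {σ} {seen} {τ = τ} {row} {z} x z∉ widen inv = record
    { allowed  = λ i {y} y∈ → widen (λ y≡z → z∉ i (subst (_∈ lookup row i) y≡z y∈)) (allowed i y∈)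
    ; size     = size
    ; value    = λ i → subst (λ S → fromℕ ∣ lookup row i ∣ * τ ≤ fromℕ k * f S) (same i) (value i)
    ; disjoint = λ {i} {i′} x∈ x∈′ → disjoint (subst (_ ∈_) (sym (same i)) x∈) (subst (_ ∈_) (sym (same i′)) x∈′)
    ; handled  = λ i x∈ → moved i (handled i x∈)
    }
    where
    open RowInvariant inv
    same : ∀ i → contents σ (lookup row i) ≡ contents (σ [ z ]≔ x) (lookup row i)
    same i = sym (contents-overwrite σ x (z∉ i))
    moved : ∀ i {y} → Handled σ τ row i y → Handled (σ [ z ]≔ x) τ row i y
    moved i (inj₁ (i′ , y∈))     = inj₁ (i′ , subst (_ ∈_) (same i′) y∈)
    moved i (inj₂ (inj₁ full))   = inj₂ (inj₁ full)
    moved i {y} (inj₂ (inj₂ small)) = inj₂ (inj₂ (subst (λ S → SmallGain (fromℕ k) τ S y) (same i) small))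

  insertRow-lookup : ∀ row i z i′ →
                     (i′ ≡ i × lookup (insertRow row i z) i′ ≡ lookup row i [ z ]≔ true) ⊎
                     (lookup (insertRow row i z) i′ ≡ lookup row i′)
  insertRow-lookup row i z i′ with i′ Fin.≟ i
  ... | yes refl = inj₁ (refl , Vec.lookup∘updateAt i row)
  ... | no i′≢i  = inj₂ (Vec.lookup∘updateAt′ i′ i i′≢i row)

  insertRow-⊆ : ∀ row i z i′ → lookup row i′ ⊆ lookup (insertRow row i z) i′
  insertRow-⊆ row i z i′ y∈ with insertRow-lookup row i z i′
  ... | inj₁ (refl , eq) = subst (_ ∈_) (sym eq) (p⊆p[x]≔ (lookup row i) z y∈)
  ... | inj₂ eq          = subst (_ ∈_) (sym eq) y∈

  -- Membership and fullness persist as sets grow. A small gain persists by diminishing returns,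
  -- unless `x` itself has just entered, which turns it into membership.
  handled-insert : ∀ {σ τ row i z i′ x} → Handled σ τ row i′ x → Handled σ τ (insertRow row i z) i′ x
  handled-insert {σ} {row = row} {i} {z} (inj₁ (i″ , x∈)) = inj₁ (i″ , contents-⊆ σ (insertRow-⊆ row i z i″) x∈)
  handled-insert {row = row} {i} {z} {i′} (inj₂ (inj₁ full)) =
    inj₂ (inj₁ (ℕ.≤-trans full (p⊆q⇒∣p∣≤∣q∣ (insertRow-⊆ row i z i′))))
  handled-insert {σ} {row = row} {i} {z} {i′} {x} (inj₂ (inj₂ small)) with x ∈? contents σ (lookup (insertRow row i z) i′)
  ... | yes x∈ = inj₁ (i′ , x∈)
  ... | no  x∉ = inj₂ (inj₂ (smallGain-⊆ (0≤fromℕ k) (contents-⊆ σ (insertRow-⊆ row i z i′)) x∉ small))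

  -- `unique` turns the test on slots into one on elements: a set containing the element of `z`
  -- would have to use slot `z`. So the element is new to the row, and its gain above τ/k pays for
  -- the extra slot in `value`.
  row-insert : ∀ {σ seen Allowed τ row i z} → Allowed z → (∀ {y} → Allowed y → lookup σ y ≡ lookup σ z → y ≡ z) →
               Eligible row i z → ¬ SmallGain (fromℕ k) τ (contents σ (lookup row i)) (lookup σ z) →
               RowInvariant σ seen Allowed τ row → RowInvariant σ seen Allowed τ (insertRow row i z)
  row-insert {σ} {seen} {Allowed} {τ} {row} {i} {z} z-allowed unique (z∉ , unfilled) gain inv = record
    { allowed = allowed′ ; size = size′ ; value = value′ ; disjoint = disjoint′
    ; handled = λ i′ x∈ → handled-insert {σ} {row = row} (handled i′ x∈) }
    where
    open RowInvariant inv
    m = lookup row i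
    ∣m+z∣ : ∣ m [ z ]≔ true ∣ ≡ suc ∣ m ∣
    ∣m+z∣ = ∣p[x]≔∣ m (z∉ i)
    new : ∀ {i′} → lookup σ z ∉ contents σ (lookup row i′)
    new {i′} x∈ with y , y∈ , eq ← ∈contents⁻ σ (lookup row i′) x∈ =
      z∉ i′ (subst (_∈ lookup row i′) (unique (allowed i′ y∈) eq) y∈)
    allowed′ : ∀ i′ {y} → y ∈ lookup (insertRow row i z) i′ → Allowed y
    allowed′ i′ y∈ with insertRow-lookup row i z i′
    ... | inj₂ eq = allowed i′ (subst (_ ∈_) eq y∈)
    ... | inj₁ (refl , eq) with y∈p[x]≔⁻ m z (subst (_ ∈_) eq y∈)
    ...   | inj₁ refl = z-allowed
    ...   | inj₂ y∈m  = allowed i y∈m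
    size′ : ∀ i′ → ∣ lookup (insertRow row i z) i′ ∣ ℕ.≤ k
    size′ i′ with insertRow-lookup row i z i′
    ... | inj₂ eq          = subst (λ q → ∣ q ∣ ℕ.≤ k) (sym eq) (size i′)
    ... | inj₁ (refl , eq) = subst (λ q → ∣ q ∣ ℕ.≤ k) (sym eq) (subst (ℕ._≤ k) (sym ∣m+z∣) unfilled)
    value′ : ∀ i′ → fromℕ ∣ lookup (insertRow row i z) i′ ∣ * τ ≤ fromℕ k * f (contents σ (lookup (insertRow row i z) i′))
    value′ i′ with insertRow-lookup row i z i′
    ... | inj₂ eq          = subst (λ q → fromℕ ∣ q ∣ * τ ≤ fromℕ k * f (contents σ q)) (sym eq) (value i′)
    ... | inj₁ (refl , eq) = subst (λ q → fromℕ ∣ q ∣ * τ ≤ fromℕ k * f (contents σ q)) (sym eq) (begin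
      fromℕ ∣ m [ z ]≔ true ∣ * τ                    ≡⟨ cong (λ l → fromℕ l * τ) ∣m+z∣ ⟩
      (1# + fromℕ ∣ m ∣) * τ                         ≈⟨ solve 2 (λ l t → (con 1 :+ l) :* t := l :* t :+ t)
              ≈-refl (fromℕ ∣ m ∣) τ ⟩
      fromℕ ∣ m ∣ * τ + τ                            ≤⟨ +-monoˡ-≤ τ (value i) ⟩
      fromℕ k * f (contents σ m) + τ                 ≤⟨ ≰⇒≥ gain ⟩
      fromℕ k * f (⁅ lookup σ z ⁆ ∪ contents σ m)    ≡⟨ cong (λ S → fromℕ k * f S) (contents-insert σ m z) ⟨
      fromℕ k * f (contents σ (m [ z ]≔ true))       ∎)
    member : ∀ i′ {x} → x ∈ contents σ (lookup (insertRow row i z) i′) →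
             (i′ ≡ i × x ≡ lookup σ z) ⊎ x ∈ contents σ (lookup row i′)
    member i′ x∈ with insertRow-lookup row i z i′
    ... | inj₂ eq = inj₂ (subst (λ q → _ ∈ contents σ q) eq x∈)
    ... | inj₁ (refl , eq) with x∈p∪q⁻ ⁅ lookup σ z ⁆ _ (subst (_ ∈_) (trans (cong (contents σ) eq) (contents-insert σ m z)) x∈)
    ...   | inj₁ x∈⁅⁆ = inj₁ (refl , x∈⁅y⁆⇒x≡y _ x∈⁅⁆)
    ...   | inj₂ x∈m  = inj₂ x∈m
    disjoint′ : ∀ {i₁ i₂ x} → x ∈ contents σ (lookup (insertRow row i z) i₁) →
                x ∈ contents σ (lookup (insertRow row i z) i₂) → i₁ ≡ i₂
    disjoint′ {i₁} {i₂} x∈₁ x∈₂ with member i₁ x∈₁ | member i₂ x∈₂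
    ... | inj₁ (refl , refl) | inj₁ (refl , _)    = refl
    ... | inj₁ (refl , refl) | inj₂ x∈            = contradiction x∈ new
    ... | inj₂ x∈            | inj₁ (refl , refl) = contradiction x∈ new
    ... | inj₂ x∈₁′          | inj₂ x∈₂′          = disjoint x∈₁′ x∈₂′

  row-finish : ∀ {σ seen Allowed Allowed′ τ row x} → (∀ {y} → Allowed y → Allowed′ y) →
               (∀ i → Handled σ τ row i x) →
               RowInvariant σ seen Allowed τ row → RowInvariant σ (x ∷ seen) Allowed′ τ row
  row-finish {σ} {seen} {τ = τ} {row} {x} widen x-handled inv = record
    { allowed = λ i → widen ∘ allowed i ; size = size ; value = value ; disjoint = disjoint ; handled = handled′ }
    where
    open RowInvariant inv
    handled′ : ∀ i {y} → y ∈ₗ x ∷ seen → Handled σ τ row i y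
    handled′ i (here refl) = x-handled i
    handled′ i (there y∈)  = handled i y∈

  free-unused : ∀ {M} → (∀ j i → ∣ lookup (lookup M j) i ∣ ℕ.≤ k) → ∀ j i → free M ∉ lookup (lookup M j) i
  free-unused {M} small j i with nonempty? (∁ (used M))
  ... | yes (z , z∈∁) = λ z∈ → x∈∁p⇒x∉p z∈∁ (∈⋃ᶠ⁺ _ j (∈⋃ᶠ⁺ _ i z∈))
  ... | no  empty     = contradiction (∣p∣<n⇒Nonempty-∁ (used M) (ℕ.s≤s used≤)) empty
    where
    used≤ : ∣ used M ∣ ℕ.≤ G ℕ.* k
    used≤ = ℕ.≤-trans (∣⋃ᶠ∣≤ _ (λ j → ∣⋃ᶠ∣≤ _ (small j))) (ℕ.≤-reflexive (sym (ℕ.*-assoc W p k)))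

-- One step of a countdown, where the indices already dealt with are those at or above the counter.
extend-below : ∀ {N a} {P : Fin N → Set a} {t} → (∀ u → suc (toℕ t) ℕ.≤ toℕ u → P u) → P t →
               ∀ u → toℕ (inject₁ t) ℕ.≤ toℕ u → P u
extend-below {P = P} {t} above now u t≤u with ℕ.m≤n⇒m<n∨m≡n (subst (ℕ._≤ toℕ u) (Fin.toℕ-inject₁ t) t≤u)
... | inj₁ t<u = above u t<u
... | inj₂ t≡u = subst P (Fin.toℕ-injective t≡u) now

-- Execution of the machine

module Runs {c ℓ₁ ℓ₂} (𝔽 : ArchimedeanField c ℓ₁ ℓ₂) (k W p : ℕ) (ρ : ArchimedeanField.Carrier 𝔽)
            {n : ℕ} (f : Subset n → ArchimedeanField.Carrier 𝔽)
            (nonNegative : Streaming.NonNegative 𝔽 f) (submodular : Streaming.Submodular 𝔽 f) where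
  open ArchimedeanField 𝔽 hiding (zero)
    renaming (refl to ≈-refl; sym to ≈-sym; trans to ≈-trans; reflexive to ≈-reflexive)
  open Streaming 𝔽
  open Arithmetic 𝔽
  open Submodularity 𝔽 f nonNegative submodular
  open Contents 𝔽
  open Sieve 𝔽 k W p ρ
  open Execution machine f
  open Correctness 𝔽 k W p ρ f nonNegative submodular
  open ≤-Reasoning

  Best : Vec (Fin n) B → Subset n → Set ℓ₂
  Best σ A = ∣ A ∣ ℕ.≤ k × (∀ m → ∣ m ∣ ℕ.≤ k → f (contents σ m) ≤ f A)

  record Outcome (A : Subset n) : Set (c ⊔ ℓ₂) where
    field
      {σ}       : Vec (Fin n) B
      {seen}    : List (Fin n)
      {base}    : Carrier
      {M}       : Masks
      invariant : Invariant σ seen (λ y → lookup σ y ∈ₗ seen) base M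
      all-seen  : ∀ x → x ∈ₗ seen
      best      : Best σ A

  -- The program flips no coins, so a run ends in a point distribution and `Q` is an ordinary
  -- postcondition.
  Halts : ∀ {q} (Q : Subset n → Set q) → Config → Set (c ⊔ q)
  Halts Q x = ∃[ A ] (x ⇓ return A) × Q A

  module _ {q} {Q : Subset n → Set q} where

    continue : ∀ {q ns σ xs act y} → decide (program q) ns ≡ act → perform act ns σ xs ≡ step y →
               Halts Q y → Halts Q (config q ns σ xs)
    continue {ns = ns} {σ} {xs} eq eq′ (A , y⇓ , QA) =
      A , step (trans (cong (λ act → perform act ns σ xs) eq) eq′) y⇓ , QA

  -- Copying the element memory slot by slot is the identity only up to a proof, hence the rewriting
  -- at each simulated step.
  kept : (σ : Vec (Fin n) B) → Vec.map (lookup σ) (allFin B) ≡ σ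
  kept = Vec.map-lookup-allFin

  searching-halts : ∀ {σ} t best v → ∣ best ∣ ℕ.≤ k → v ≤ f (contents σ best) →
                    (∀ u → toℕ t ℕ.≤ toℕ u → f (contents σ (candidate u)) ≤ v) →
                    Halts (Best σ) (config (searching t best) (v ∷ []) σ [])
  searching-halts {σ} = <-weakInduction _ finish search
    where
    finish : ∀ best v → ∣ best ∣ ℕ.≤ k → v ≤ f (contents σ best) →
             (∀ u → 0 ℕ.≤ toℕ u → f (contents σ (candidate u)) ≤ v) →
             Halts (Best σ) (config (searching zero best) (v ∷ []) σ [])
    finish best v ∣best∣≤k v≤ tried =
      contents σ best , halt refl , ℕ.≤-trans (∣contents∣≤ σ best) ∣best∣≤k , λ m ∣m∣≤k → begin
        f (contents σ m)                      ≡⟨ cong (f ∘ contents σ) (recover m ∣m∣≤k) ⟨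
        f (contents σ (candidate (rank m)))   ≤⟨ tried (rank m) ℕ.z≤n ⟩
        v                                     ≤⟨ v≤ ⟩
        f (contents σ best)                   ∎
      where
      recover : ∀ m → ∣ m ∣ ℕ.≤ k → candidate (rank m) ≡ m
      recover m ∣m∣≤k = trans (cong (capped k) (unrank∘rank m)) (capped-small m ∣m∣≤k)
    search : ∀ t →
             (∀ best v → ∣ best ∣ ℕ.≤ k → v ≤ f (contents σ best) →
               (∀ u → toℕ (inject₁ t) ℕ.≤ toℕ u → f (contents σ (candidate u)) ≤ v) →
               Halts (Best σ) (config (searching (inject₁ t) best) (v ∷ []) σ [])) →
             ∀ best v → ∣ best ∣ ℕ.≤ k → v ≤ f (contents σ best) →
             (∀ u → suc (toℕ t) ℕ.≤ toℕ u → f (contents σ (candidate u)) ≤ v) →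
             Halts (Best σ) (config (searching (suc t) best) (v ∷ []) σ [])
    search t rec best v ∣best∣≤k v≤ tried =
      continue refl (cong (λ σ′ → step (config (searched t best) (w ∷ v ∷ []) σ′ [])) (kept σ)) compare
      where
      w = f (contents σ (candidate t))
      extend : ∀ {v′} → v ≤ v′ → w ≤ v′ → ∀ u → toℕ (inject₁ t) ℕ.≤ toℕ u → f (contents σ (candidate u)) ≤ v′
      extend v≤v′ = extend-below (λ u t<u → ≤-trans (tried u t<u) v≤v′)
      compare : Halts (Best σ) (config (searched t best) (w ∷ v ∷ []) σ [])
      compare with w ≤? v
      ... | yes w≤v = continue (if-yes (w ≤? v) w≤v)
          (cong (λ σ′ → step (config (searching (inject₁ t) best) (v ∷ []) σ′ [])) (kept σ))
          (rec best v ∣best∣≤k v≤ (extend ≤-refl w≤v))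
      ... | no  w≰v = continue (if-no (w ≤? v) w≰v)
          (cong (λ σ′ → step (config (searching (inject₁ t) (candidate t)) (w ∷ []) σ′ [])) (kept σ))
          (rec (candidate t) w (∣capped∣≤ k (unrank B t)) ≤-refl (extend (≰⇒≥ w≰v) ≤-refl))

  insert-lookup : ∀ M j i z j′ →
                  (j′ ≡ j × lookup (insert M j i z) j′ ≡ insertRow (lookup M j) i z) ⊎
                  (lookup (insert M j i z) j′ ≡ lookup M j′)
  insert-lookup M j i z j′ with j′ Fin.≟ j
  ... | yes refl = inj₁ (refl , Vec.lookup∘updateAt j M)
  ... | no j′≢j  = inj₂ (Vec.lookup∘updateAt′ j′ j j′≢j M)

  Settled : Vec (Fin n) B → Carrier → Masks → Fin n → Fin G → Set ℓ₂
  Settled σ base M x g = Handled σ (base * ρ ^ toℕ (threshold g)) (lookup M (threshold g)) (level g) x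

  settled-insert : ∀ {σ base M x j i z} g → Settled σ base M x g → Settled σ base (insert M j i z) x g
  settled-insert {σ} {base} {M} {x} {j} {i} {z} g settled with insert-lookup M j i z (threshold g)
  ... | inj₁ (j′≡j , eq) = subst (λ row → Handled σ τ row (level g) x) (sym eq)
          (handled-insert {σ} {τ} {lookup M j} (subst (λ j′ → Handled σ τ (lookup M j′) (level g) x) j′≡j settled))
    where τ = base * ρ ^ toℕ (threshold g)
  ... | inj₂ eq = subst (λ row → Handled σ (base * ρ ^ toℕ (threshold g)) row (level g) x) (sym eq) settled

  -- While the element in slot z is being offered, z is the only slot that may hold an unseen element.
  Slot : Vec (Fin n) B → List (Fin n) → Fin B → Fin B → Set
  Slot σ seen z y = y ≡ z ⊎ lookup σ y ∈ₗ seen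

  module Offering {q} {Q : Subset n → Set q} {σ : Vec (Fin n) B} {seen : List (Fin n)} {z : Fin B} {base : Carrier}
                  {xs : List (Fin n)} (new : ¬ lookup σ z ∈ₗ seen) where

    x = lookup σ z

    Inv : Masks → Set ℓ₂
    Inv = Invariant σ seen (Slot σ seen z) base

    invariant-insert : ∀ {M j i} → Inv M → Eligible (lookup M j) i z →
                       ¬ SmallGain (fromℕ k) (base * ρ ^ toℕ j) (contents σ (lookup (lookup M j) i)) x →
                       Inv (insert M j i z)
    invariant-insert {M} {j} {i} inv eligible gain = record
      { base-nonNeg = base-nonNeg ; base-low = base-low ; base-high = base-high ; rows = rows′ }
      where
      open Invariant inv
      unique : ∀ {y} → Slot σ seen z y → lookup σ y ≡ x → y ≡ z
      unique (inj₁ y≡z)    _  = y≡z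
      unique (inj₂ y-seen) eq = contradiction (subst (_∈ₗ seen) eq y-seen) new
      rows′ : ∀ j′ → RowInvariant σ seen (Slot σ seen z) (base * ρ ^ toℕ j′) (lookup (insert M j i z) j′)
      rows′ j′ with insert-lookup M j i z j′
      ... | inj₁ (refl , eq) = subst (RowInvariant σ seen _ _) (sym eq) (row-insert (inj₁ refl) unique eligible gain (rows j))
      ... | inj₂ eq          = subst (RowInvariant σ seen _ _) (sym eq) (rows j′)

    Ready : Fin (suc G) → Set (c ⊔ ℓ₂ ⊔ q)
    Ready t = ∀ M → Inv M → (∀ g → toℕ t ℕ.≤ toℕ g → Settled σ base M x g) →
              Halts Q (config (offering M z t) (base ∷ []) σ xs)

    offer : ∀ g → Ready (inject₁ g) → Ready (suc g)
    offer g rec M inv settled with eligible? (lookup M (threshold g)) (level g) z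
    ... | no ineligible =
      continue (if-no (eligible? row i z) ineligible)
        (cong (λ σ′ → step (config (offering M z (inject₁ g)) (base ∷ []) σ′ xs)) (kept σ))
        (rec M inv (extend-below settled reason))
      where
      row = lookup M (threshold g)
      i = level g
      reason : Settled σ base M x g
      -- Ineligible means already in this row or facing a full set; both count as handled.
      reason with Fin.any? (λ i′ → z ∈? lookup row i′)
      ... | yes (i′ , z∈) = inj₁ (i′ , ∈contents⁺ σ z∈)
      ... | no  z∉        = inj₂ (inj₁ (ℕ.≮⇒≥ λ unfilled → ineligible ((λ i′ z∈ → z∉ (i′ , z∈)) , unfilled)))
    ... | yes eligible =
      continue (if-yes (eligible? row i z) eligible)
        (cong (λ σ′ → step (config (queried₁ M z g) (s ∷ base ∷ []) σ′ xs)) (kept σ))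
        (continue refl (cong (λ σ′ → step (config (queried₂ M z g) (s⁺ ∷ s ∷ base ∷ []) σ′ xs)) (kept σ)) compare)
      where
      j = threshold g
      i = level g
      row = lookup M j
      m = lookup row i
      s = f (contents σ m)
      s⁺ = f (contents σ (m [ z ]≔ true))
      τ = base * ρ ^ toℕ j
      joined : Settled σ base (insert M j i z) x g
      joined = inj₁ (i , subst (λ m′ → x ∈ contents σ m′) (sym eq) (∈contents⁺ σ (x∈p[x]≔ m z)))
        where
        eq : lookup (lookup (insert M j i z) j) i ≡ m [ z ]≔ true
        eq = trans (cong (λ r → lookup r i) (Vec.lookup∘updateAt j M)) (Vec.lookup∘updateAt i row)
      s⁺-def : s⁺ ≡ f (⁅ x ⁆ ∪ contents σ m)
      s⁺-def = cong f (contents-insert σ m z)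
      compare : Halts Q (config (queried₂ M z g) (s⁺ ∷ s ∷ base ∷ []) σ xs)
      compare with fromℕ k * s⁺ ≤? fromℕ k * s + τ
      ... | yes small = continue (if-yes (fromℕ k * s⁺ ≤? fromℕ k * s + τ) small)
        (cong (λ σ′ → step (config (offering M z (inject₁ g)) (base ∷ []) σ′ xs)) (kept σ))
        (rec M inv (extend-below settled (inj₂ (inj₂ (subst (λ v → fromℕ k * v ≤ fromℕ k * s + τ) s⁺-def small)))))
      ... | no large = continue (if-no (fromℕ k * s⁺ ≤? fromℕ k * s + τ) large)
        (cong (λ σ′ → step (config (offering (insert M j i z) z (inject₁ g)) (base ∷ []) σ′ xs)) (kept σ))
        (rec (insert M j i z)
          (invariant-insert inv eligible (λ small → large (subst (λ v → fromℕ k * v ≤ fromℕ k * s + τ) (sym s⁺-def) small)))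
          (extend-below (λ g′ g<g′ → settled-insert {σ} {base} {M} g′ (settled g′ g<g′)) joined))

    offering-halts : Ready zero → ∀ {M} → Inv M → Halts Q (config (offering M z (Fin.fromℕ G)) (base ∷ []) σ xs)
    offering-halts ready {M} inv = <-weakInduction Ready ready offer (Fin.fromℕ G) M inv
      (λ g G≤g → contradiction (subst (ℕ._≤ toℕ g) (Fin.toℕ-fromℕ G) G≤g) (ℕ.<⇒≱ (Fin.toℕ<n g)))

  module Scaling (1≤k : 1 ℕ.≤ k) (1≤ρ : 1# ≤ ρ) (3ρ≤6 : fromℕ 3 * ρ ≤ fromℕ 6) (6k≤R : fromℕ 6 * fromℕ k ≤ R)
                 {q} {Q : Subset n → Set q} {σ : Vec (Fin n) B} {seen : List (Fin n)} {Allowed : Fin B → Set}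
                 {z : Fin B} {xs : List (Fin n)} where

    v = f ⁅ lookup σ z ⁆

    0≤ρ : 0# ≤ ρ
    0≤ρ = ≤-trans 0≤1 1≤ρ

    0≤R : 0# ≤ R
    0≤R = 0≤^ 0≤ρ W

    0<3 : 0# < fromℕ 3
    0<3 = 0<fromℕ {3} (ℕ.s≤s ℕ.z≤n)

    third : fromℕ 3 * (v * fromℕ 3 ⁻¹) ≈ v
    third = ≈-trans (solve 3 (λ a b c → a :* (b :* c) := b :* (a :* c)) ≈-refl (fromℕ 3) v (fromℕ 3 ⁻¹))
      (≈-trans (*-congˡ (inverseʳ 0<3)) (*-identityʳ v))

    0≤third : 0# ≤ v * fromℕ 3 ⁻¹
    0≤third = *-nonNeg (nonNegative _) (0≤⁻¹ 0<3)

    v≤optimum : ∀ O → IsOptimal f k O → v ≤ f O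
    v≤optimum O (_ , optimal) = optimal ⁅ lookup σ z ⁆ (ℕ.≤-trans (ℕ.≤-reflexive (∣⁅x⁆∣≡1 (lookup σ z))) 1≤k)

    -- The failed window test gives `base * R` ≤ k v. With 3ρ ≤ 6 and 6k ≤ R this yields 3
    -- `base * ρ` ≤ v ≤ f(OPT), so the lowest guess remains valid. The row that enters has the guess
    -- `base * R`, for which empty sets are correct.
    invariant-shift : ∀ {base M} → base * R ≤ fromℕ k * v → Invariant σ seen Allowed base M →
                      Invariant σ seen Allowed (base * ρ) (push emptyRow M)
    invariant-shift {base} {M} low inv = record
      { base-nonNeg = *-nonNeg base-nonNeg 0≤ρ
      ; base-low    = λ O optimal → ≤-trans 3baseρ≤v (v≤optimum O optimal)
      ; base-high   = λ x∈ → ≤-trans (base-high x∈) (*-monoʳ-≤ 0≤R base≤baseρ)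
      ; rows        = rows′
      }
      where
      open Invariant inv
      base≤baseρ : base ≤ base * ρ
      base≤baseρ = ≤-trans (≤-reflexive (≈-sym (*-identityʳ base))) (*-monoˡ-≤ base-nonNeg 1≤ρ)
      3baseρ≤v : fromℕ 3 * (base * ρ) ≤ v
      3baseρ≤v = *-cancelˡ-≤ (0<fromℕ 1≤k) (begin
        fromℕ k * (fromℕ 3 * (base * ρ))  ≈⟨ solve 4 (λ k t b r → k :* (t :* (b :* r)) := (t :* r) :* (k :* b))
                ≈-refl (fromℕ k) (fromℕ 3) base ρ ⟩
        (fromℕ 3 * ρ) * (fromℕ k * base)  ≤⟨ *-monoʳ-≤ (*-nonNeg (0≤fromℕ k) base-nonNeg) 3ρ≤6 ⟩
        fromℕ 6 * (fromℕ k * base)        ≈⟨ solve 3 (λ s k b → s :* (k :* b) := b :* (s :* k))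
                ≈-refl (fromℕ 6) (fromℕ k) base ⟩
        base * (fromℕ 6 * fromℕ k)        ≤⟨ *-monoˡ-≤ base-nonNeg 6k≤R ⟩
        base * R                          ≤⟨ low ⟩
        fromℕ k * v                       ∎)
      rows′ : ∀ j → RowInvariant σ seen Allowed (base * ρ * ρ ^ toℕ j) (lookup (push emptyRow M) j)
      rows′ j with lookup-push emptyRow M j
      ... | inj₁ (last , eq) = subst (RowInvariant σ seen _ _) (sym eq) (row-empty λ {x} x∈ → begin
        fromℕ k * f ⁅ x ⁆       ≤⟨ base-high x∈ ⟩
        base * ρ ^ W            ≡⟨ cong (λ e → base * ρ ^ e) last ⟨
        base * (ρ * ρ ^ toℕ j)  ≈⟨ *-assoc base ρ _ ⟨
        base * ρ * ρ ^ toℕ j    ∎)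
      ... | inj₂ (j′ , next , eq) = subst (RowInvariant σ seen _ _) (sym eq)
        (row-resp-≈ (≈-trans (≈-reflexive (cong (λ e → base * ρ ^ e) next)) (≈-sym (*-assoc base ρ _))) (rows j′))

    -- All new guesses are at least v/3, hence at least `base * R`, so every row may be empty; and
    -- three times the new base is v ≤ f(OPT).
    invariant-reset : ∀ {base M} → fromℕ 3 * (base * R) ≤ v → Invariant σ seen Allowed base M →
                      Invariant σ seen Allowed (v * fromℕ 3 ⁻¹) emptyMasks
    invariant-reset {base} {M} low inv = record
      { base-nonNeg = 0≤third
      ; base-low    = λ O optimal → ≤-trans (≤-reflexive third) (v≤optimum O optimal)
      ; base-high   = λ x∈ → above x∈ W
      ; rows        = λ j → subst (RowInvariant σ seen _ _) (sym (Vec.lookup-replicate j emptyRow))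
                              (row-empty λ x∈ → above x∈ (toℕ j))
      }
      where
      open Invariant inv
      above : ∀ {x} → x ∈ₗ seen → ∀ e → fromℕ k * f ⁅ x ⁆ ≤ v * fromℕ 3 ⁻¹ * ρ ^ e
      above {x} x∈ e = begin
        fromℕ k * f ⁅ x ⁆          ≤⟨ base-high x∈ ⟩
        base * R                   ≤⟨ *-cancelˡ-≤ 0<3 (≤-trans low (≤-reflexive (≈-sym third))) ⟩
        v * fromℕ 3 ⁻¹             ≈⟨ *-identityʳ _ ⟨
        v * fromℕ 3 ⁻¹ * 1#        ≤⟨ *-monoˡ-≤ 0≤third (1≤^ 1≤ρ e) ⟩
        v * fromℕ 3 ⁻¹ * ρ ^ e     ∎

    reset-high : fromℕ k * v ≤ v * fromℕ 3 ⁻¹ * R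
    reset-high = begin
      fromℕ k * v                              ≈⟨ *-congˡ third ⟨
      fromℕ k * (fromℕ 3 * (v * fromℕ 3 ⁻¹))   ≈⟨ solve 3 (λ k t u → k :* (t :* u) := u :* (t :* k))
              ≈-refl (fromℕ k) (fromℕ 3) (v * fromℕ 3 ⁻¹) ⟩
      v * fromℕ 3 ⁻¹ * (fromℕ 3 * fromℕ k)
          ≤⟨ *-monoˡ-≤ 0≤third (*-monoʳ-≤ (0≤fromℕ k) (fromℕ-mono-≤ {3} {6} (ℕ.s≤s (ℕ.s≤s (ℕ.s≤s ℕ.z≤n))))) ⟩
      v * fromℕ 3 ⁻¹ * (fromℕ 6 * fromℕ k)     ≤⟨ *-monoˡ-≤ 0≤third 6k≤R ⟩
      v * fromℕ 3 ⁻¹ * R                       ∎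

    Ready : Carrier → Masks → Set (c ⊔ ℓ₂ ⊔ q)
    Ready base M = Invariant σ seen Allowed base M → fromℕ k * v ≤ base * R →
                   Halts Q (config (offering M z (Fin.fromℕ G)) (base ∷ []) σ xs)

    -- t bounds the number of shifts left.
    scaling-loop : (∀ {base M} → Ready base M) → ∀ t {base M} → Invariant σ seen Allowed base M →
                   fromℕ 3 * (base * R) ≤ v ⊎ fromℕ k * v ≤ base * R * ρ ^ t →
                   Halts Q (config (scaling M z) (v ∷ base ∷ []) σ xs)
    scaling-loop ready t {base} {M} inv fuel with fromℕ k * v ≤? base * R
    ... | yes enough = continue (if-yes (fromℕ k * v ≤? base * R) enough)
      (cong (λ σ′ → step (config (offering M z (Fin.fromℕ G)) (base ∷ []) σ′ xs)) (kept σ))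
      (ready inv enough)
    ... | no short with fromℕ 3 * (base * R) ≤? v
    ...   | yes jump = continue (trans (if-no (fromℕ k * v ≤? base * R) short) (if-yes (fromℕ 3 * (base * R) ≤? v) jump))
      (cong (λ σ′ → step (config (offering emptyMasks z (Fin.fromℕ G)) (v * fromℕ 3 ⁻¹ ∷ []) σ′ xs)) (kept σ))
      (ready (invariant-reset jump inv) reset-high)
    ...   | no near with t | fuel
    ...     | _     | inj₁ jump = contradiction jump near
    ...     | zero  | inj₂ kv≤ = contradiction (≤-trans kv≤ (≤-reflexive (*-identityʳ _))) short
    ...     | suc t | inj₂ kv≤ = continue (trans (if-no (fromℕ k * v ≤? base * R) short) (if-no (fromℕ 3 * (base * R) ≤? v) near))
      (cong (λ σ′ → step (config (scaling (push emptyRow M) z) (v ∷ base * ρ ∷ []) σ′ xs)) (kept σ))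
      (scaling-loop ready t (invariant-shift (≰⇒≥ short) inv) (inj₂ (begin
        fromℕ k * v                 ≤⟨ kv≤ ⟩
        base * R * (ρ * ρ ^ t)      ≈⟨ solve 4 (λ b r p t → b :* r :* (p :* t) := b :* p :* r :* t)
                ≈-refl base R ρ (ρ ^ t) ⟩
        base * ρ * R * ρ ^ t        ∎)))

    arrived-halts : (∀ {base M} → Ready base M) → ∀ {base M} → Invariant σ seen Allowed base M →
                    Halts Q (config (arrived M z) (base ∷ []) σ xs)
    arrived-halts ready {base} {M} inv =
      continue refl (trans
          (cong (λ u → step (config (scaling M z) (u ∷ base ∷ []) (Vec.map (lookup σ) (allFin B)) xs)) (cong f (contents-⁅⁆ σ z)))
          (cong (λ σ′ → step (config (scaling M z) (v ∷ base ∷ []) σ′ xs)) (kept σ)))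
        (scaling-loop ready W inv fuel)
      where
      open Invariant inv
      0≤baseR : 0# ≤ base * R
      0≤baseR = *-nonNeg base-nonNeg 0≤R
      -- If no restart is due, k v ≤ 3k `base * R` ≤ `base * R * R`, so `W` shifts are enough.
      fuel : fromℕ 3 * (base * R) ≤ v ⊎ fromℕ k * v ≤ base * R * ρ ^ W
      fuel with ≤-total (fromℕ 3 * (base * R)) v
      ... | inj₁ jump = inj₁ jump
      ... | inj₂ near = inj₂ (begin
        fromℕ k * v                         ≤⟨ *-monoˡ-≤ (0≤fromℕ k) near ⟩
        fromℕ k * (fromℕ 3 * (base * R))    ≈⟨ solve 3 (λ k t b → k :* (t :* b) := b :* (t :* k))
                ≈-refl (fromℕ k) (fromℕ 3) (base * R) ⟩
        base * R * (fromℕ 3 * fromℕ k)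
            ≤⟨ *-monoˡ-≤ 0≤baseR (*-monoʳ-≤ (0≤fromℕ k) (fromℕ-mono-≤ {3} {6} (ℕ.s≤s (ℕ.s≤s (ℕ.s≤s ℕ.z≤n))))) ⟩
        base * R * (fromℕ 6 * fromℕ k)      ≤⟨ *-monoˡ-≤ 0≤baseR 6k≤R ⟩
        base * R * R                        ∎)

  module Stream (1≤k : 1 ℕ.≤ k) (1≤ρ : 1# ≤ ρ) (3ρ≤6 : fromℕ 3 * ρ ≤ fromℕ 6) (6k≤R : fromℕ 6 * fromℕ k ≤ R) where

    Resting : Vec (Fin n) B → List (Fin n) → Carrier → Masks → Set ℓ₂
    Resting σ seen = Invariant σ seen (λ y → lookup σ y ∈ₗ seen)

    settle : ∀ {σ seen z base M} → Invariant σ seen (Slot σ seen z) base M →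
             fromℕ k * f ⁅ lookup σ z ⁆ ≤ base * R → (∀ g → Settled σ base M (lookup σ z) g) →
             Resting σ (lookup σ z ∷ seen) base M
    settle {σ} {seen} {z} {base} {M} inv high settled = record
      { base-nonNeg = base-nonNeg
      ; base-low    = base-low
      ; base-high   = λ { (here refl) → high ; (there x∈) → base-high x∈ }
      ; rows        = λ j → row-finish (λ { (inj₁ refl) → here refl ; (inj₂ y∈) → there y∈ })
                              (λ i → subst (λ ji → Handled σ (base * ρ ^ toℕ (proj₁ ji)) (lookup M (proj₁ ji)) (proj₂ ji) (lookup σ z))
                                       (Fin.remQuot-combine j i) (settled (combine j i)))
                              (rows j)
      }
      where open Invariant inv

    store : ∀ {σ seen base M} x → Resting σ seen base M →
            Invariant (σ [ free M ]≔ x) seen (Slot (σ [ free M ]≔ x) seen (free M)) base M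
    store {σ} {seen} {base} {M} x inv = record
      { base-nonNeg = base-nonNeg
      ; base-low    = base-low
      ; base-high   = base-high
      ; rows        = λ j → row-overwrite x (free-unused {M} (λ j → RowInvariant.size (rows j)) j)
                              (λ y≢z y∈ → inj₂ (subst (_∈ₗ seen) (sym (Vec.lookup∘update′ y≢z σ x)) y∈))
                              (rows j)
      }
      where open Invariant inv

    stored : ∀ (σ : Vec (Fin n) B) z x →
             Vec.map (lookup (x ∷ σ)) (Vec.map suc (allFin B) [ z ]≔ zero) ≡ σ [ z ]≔ x
    stored σ z x = trans (Vec.map-[]≔ (lookup (x ∷ σ)) (Vec.map suc (allFin B)) z)
      (cong (_[ z ]≔ x) (trans (sym (Vec.map-∘ (lookup (x ∷ σ)) suc (allFin B))) (kept σ)))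

    mutual

      -- The side conditions say that the seen and the remaining elements partition the ground set.
      -- An arrival is therefore unseen, which makes its slot the only admissible one holding it.
      process : ∀ {xs σ seen z base M} → Invariant σ seen (Slot σ seen z) base M → Unique (lookup σ z ∷ xs) →
                (∀ {x} → x ∈ₗ lookup σ z ∷ xs → ¬ x ∈ₗ seen) → (∀ x → x ∈ₗ seen ⊎ x ∈ₗ lookup σ z ∷ xs) →
                Halts Outcome (config (arrived M z) (base ∷ []) σ xs)
      process {xs} {σ} {seen} {z} inv (head-new ∷ unique) new all =
        Scaling.arrived-halts 1≤k 1≤ρ 3ρ≤6 6k≤R
          (λ inv′ high → Offering.offering-halts (new (here refl))
            (λ M″ inv″ settled → resume xs (settle inv″ high (λ g → settled g ℕ.z≤n)) unique new′ all′) inv′)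
          inv
        where
        new′ : ∀ {x} → x ∈ₗ xs → ¬ x ∈ₗ lookup σ z ∷ seen
        new′ x∈ (here refl) = All.lookup head-new x∈ refl
        new′ x∈ (there x∈′) = new (there x∈) x∈′
        all′ : ∀ x → x ∈ₗ lookup σ z ∷ seen ⊎ x ∈ₗ xs
        all′ x with all x
        ... | inj₁ x∈         = inj₁ (there x∈)
        ... | inj₂ (here eq)  = inj₁ (here eq)
        ... | inj₂ (there x∈) = inj₂ x∈

      resume : ∀ xs {σ seen z base M} → Resting σ seen base M → Unique xs →
               (∀ {x} → x ∈ₗ xs → ¬ x ∈ₗ seen) → (∀ x → x ∈ₗ seen ⊎ x ∈ₗ xs) →
               Halts Outcome (config (offering M z zero) (base ∷ []) σ xs)
      resume [] {σ} inv unique new all =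
        continue refl (cong (λ σ′ → step (config (searching (Fin.fromℕ (2 ℕ.^ B)) ⊥) (0# ∷ []) σ′ [])) (kept σ))
          (outcome (searching-halts (Fin.fromℕ (2 ℕ.^ B)) ⊥ 0# (ℕ.≤-trans (ℕ.≤-reflexive (∣⊥∣≡0 B)) ℕ.z≤n) (nonNegative _)
            (λ u N≤u → contradiction (subst (ℕ._≤ toℕ u) (Fin.toℕ-fromℕ (2 ℕ.^ B)) N≤u) (ℕ.<⇒≱ (Fin.toℕ<n u)))))
        where
        outcome : ∀ {x} → Halts (Best σ) x → Halts Outcome x
        outcome (A , x⇓ , best) = A , x⇓ , record
          { invariant = inv ; all-seen = λ x → [ (λ x∈ → x∈) , (λ ()) ] (all x) ; best = best }
      resume (x ∷ xs) {σ} {seen} {z} {base} {M} inv unique new all =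
        continue refl (cong (λ σ′ → step (config (arrived M (free M)) (base ∷ []) σ′ xs)) (stored σ (free M) x))
          (process (store x inv) (subst (λ y → Unique (y ∷ xs)) eq unique)
            (λ {y} y∈ → new (subst (λ u → y ∈ₗ u ∷ xs) (sym eq) y∈))
            (λ y → subst (λ u → y ∈ₗ seen ⊎ y ∈ₗ u ∷ xs) eq (all y)))
        where
        eq : x ≡ lookup (σ [ free M ]≔ x) (free M)
        eq = sym (Vec.lookup∘update (free M) σ x)

    Final : Subset n → Set (c ⊔ ℓ₂)
    Final A = (¬ Fin n × A ≡ ⊥) ⊎ Outcome A

    halts : ∀ xs → Unique xs → (∀ x → x ∈ₗ xs) → Halts Final (initial xs)
    halts []       unique all =
      ⊥ , step refl (halt refl) , inj₁ ((λ x → contradiction (all x) λ ()) , refl)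
    halts (x ∷ xs) unique all =
      continue refl (cong (λ σ′ → step (config (arrived emptyMasks zero) (0# ∷ []) σ′ xs)) (Vec.map-replicate (lookup (x ∷ [])) zero B))
        -- The copies of the first element in the other slots are harmless: no mask refers to them
        -- yet.
        (final (process {σ = replicate B x} {seen = []} fresh unique (λ _ ()) (λ y → inj₂ (all y))))
      where
      final : ∀ {y} → Halts Outcome y → Halts Final y
      final (A , y⇓ , outcome) = A , y⇓ , inj₂ outcome
      fresh : Invariant (replicate B x) [] (Slot (replicate B x) [] zero) 0# emptyMasks
      fresh = record
        { base-nonNeg = ≤-refl
        ; base-low    = λ O _ → ≤-trans (≤-reflexive (zeroʳ (fromℕ 3))) (nonNegative O)
        ; base-high   = λ ()
        ; rows        = λ j → subst (RowInvariant _ _ _ _) (sym (Vec.lookup-replicate j emptyRow)) (row-empty λ ())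
        }

-- Numerical bounds

-- The left-hand side is the number of guesses; 13 = 1 + 3 + 9 after absorbing lower terms.
W≤13ql : ∀ {q l} → 1 ℕ.≤ q → 1 ℕ.≤ l → suc (3 ℕ.* q ℕ.* (3 ℕ.+ l)) ℕ.≤ 13 ℕ.* (q ℕ.* l)
W≤13ql {q} {l} 1≤q 1≤l = begin
  suc (3 ℕ.* q ℕ.* (3 ℕ.+ l))                                    ≡⟨ expand q l ⟩
  1 ℕ.+ 3 ℕ.* (q ℕ.* l) ℕ.+ 9 ℕ.* (q ℕ.* 1)
      ≤⟨ ℕ.+-mono-≤ (ℕ.+-monoˡ-≤ (3 ℕ.* (q ℕ.* l)) (ℕ.*-mono-≤ 1≤q 1≤l))
                                                                      (ℕ.*-monoʳ-≤ 9 (ℕ.*-monoʳ-≤ q 1≤l)) ⟩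
  q ℕ.* l ℕ.+ 3 ℕ.* (q ℕ.* l) ℕ.+ 9 ℕ.* (q ℕ.* l)                ≡⟨ collect (q ℕ.* l) ⟩
  13 ℕ.* (q ℕ.* l)                                               ∎
  where
  open ℕ.≤-Reasoning
  expand : ∀ q l → suc (3 ℕ.* q ℕ.* (3 ℕ.+ l)) ≡ 1 ℕ.+ 3 ℕ.* (q ℕ.* l) ℕ.+ 9 ℕ.* (q ℕ.* 1)
  expand = solve-∀
  collect : ∀ u → u ℕ.+ 3 ℕ.* u ℕ.+ 9 ℕ.* u ≡ 13 ℕ.* u
  collect = solve-∀

memory-numeric : ∀ γ l l′ k g b → g ℕ.≤ γ ℕ.* l → b ℕ.≤ γ ℕ.* l ℕ.* k →
                 21 ℕ.* (g ℕ.* b) ℕ.+ b ℕ.* l′ ℕ.≤ (21 ℕ.* (γ ℕ.* γ) ℕ.+ γ) ℕ.* (k ℕ.* (l ℕ.+ l′) ℕ.^ 2)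
memory-numeric γ l l′ k g b g≤ b≤ = begin
  21 ℕ.* (g ℕ.* b) ℕ.+ b ℕ.* l′
    ≤⟨ ℕ.+-mono-≤ (ℕ.*-monoʳ-≤ 21 (ℕ.*-mono-≤ g≤ b≤)) (ℕ.*-monoˡ-≤ l′ b≤) ⟩
  21 ℕ.* (γ ℕ.* l ℕ.* (γ ℕ.* l ℕ.* k)) ℕ.+ γ ℕ.* l ℕ.* k ℕ.* l′
    -- The added term is exactly what is missing from the expansion of the square.
    ≤⟨ ℕ.m≤m+n _ _ ⟩
  21 ℕ.* (γ ℕ.* l ℕ.* (γ ℕ.* l ℕ.* k)) ℕ.+ γ ℕ.* l ℕ.* k ℕ.* l′
    ℕ.+ (21 ℕ.* (γ ℕ.* γ) ℕ.* (k ℕ.* (2 ℕ.* (l ℕ.* l′) ℕ.+ l′ ℕ.* l′)) ℕ.+ γ ℕ.* (k ℕ.* (l ℕ.* l ℕ.+ l ℕ.* l′ ℕ.+ l′ ℕ.* l′)))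
    ≡⟨ expand γ l l′ k ⟩
  (21 ℕ.* (γ ℕ.* γ) ℕ.+ γ) ℕ.* (k ℕ.* ((l ℕ.+ l′) ℕ.* ((l ℕ.+ l′) ℕ.* 1)))  ∎
  where
  open ℕ.≤-Reasoning
  expand : ∀ γ l l′ k →
    21 ℕ.* (γ ℕ.* l ℕ.* (γ ℕ.* l ℕ.* k)) ℕ.+ γ ℕ.* l ℕ.* k ℕ.* l′
      ℕ.+ (21 ℕ.* (γ ℕ.* γ) ℕ.* (k ℕ.* (2 ℕ.* (l ℕ.* l′) ℕ.+ l′ ℕ.* l′)) ℕ.+ γ ℕ.* (k ℕ.* (l ℕ.* l ℕ.+ l ℕ.* l′ ℕ.+ l′ ℕ.* l′)))
    ≡ (21 ℕ.* (γ ℕ.* γ) ℕ.+ γ) ℕ.* (k ℕ.* ((l ℕ.+ l′) ℕ.* ((l ℕ.+ l′) ℕ.* 1)))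
  expand = solve-∀

-- Choice of parameters and the approximation ratio

module Parameters {c ℓ₁ ℓ₂} (𝔽 : ArchimedeanField c ℓ₁ ℓ₂) where
  open ArchimedeanField 𝔽 hiding (zero; setoid)
    renaming (refl to ≈-refl; sym to ≈-sym; trans to ≈-trans; reflexive to ≈-reflexive)
  open Streaming 𝔽
  open Arithmetic 𝔽
  open ≤-Reasoning

  -- An integer `q` within a factor 2 of ε⁻¹; the numbers of guesses and of sets per guess are
  -- defined from it.
  granularity : ∀ {ε} → 0# < ε → ε ≤ 1# →
                ∃[ q ] 1 ℕ.≤ q × 1# ≤ fromℕ q * ε × fromℕ q ≤ fromℕ 2 * ε ⁻¹
  granularity {ε} 0<ε ε≤1 =
    let q , 1≤q , ε⁻¹≤q , q≤2ε⁻¹ = least-fromℕ-above 1≤ε⁻¹ in q , 1≤q , 1≤qε q ε⁻¹≤q , q≤2ε⁻¹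
    where
    1≤ε⁻¹ : 1# ≤ ε ⁻¹
    1≤ε⁻¹ = *-cancelˡ-≤ 0<ε (begin
      ε * 1#    ≈⟨ *-identityʳ ε ⟩
      ε         ≤⟨ ε≤1 ⟩
      1#        ≈⟨ inverseʳ 0<ε ⟨
      ε * ε ⁻¹  ∎)
    1≤qε : ∀ q → ε ⁻¹ ≤ fromℕ q → 1# ≤ fromℕ q * ε
    1≤qε q ε⁻¹≤q = begin
      1#             ≈⟨ inverseʳ 0<ε ⟨
      ε * ε ⁻¹       ≤⟨ *-monoˡ-≤ (proj₁ 0<ε) ε⁻¹≤q ⟩
      ε * fromℕ q    ≈⟨ *-comm ε (fromℕ q) ⟩
      fromℕ q * ε    ∎

  module _ (ε : Carrier) (0≤ε : 0# ≤ ε) (ε≤1 : ε ≤ 1#) (q : ℕ) (1≤q : 1 ℕ.≤ q) (1≤qε : 1# ≤ fromℕ q * ε) where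

    -- Rounding f(OPT)/3 down to a guess costs a factor ρ, and 3ρ = 3 + ε is exactly the allowed
    -- ratio.
    3⁻¹ ρ : Carrier
    3⁻¹ = fromℕ 3 ⁻¹
    ρ   = 1# + ε * 3⁻¹

    3*3⁻¹≈1 : fromℕ 3 * 3⁻¹ ≈ 1#
    3*3⁻¹≈1 = inverseʳ (0<fromℕ {3} (ℕ.s≤s ℕ.z≤n))

    0≤ε/3 : 0# ≤ ε * 3⁻¹
    0≤ε/3 = *-nonNeg 0≤ε (0≤⁻¹ (0<fromℕ {3} (ℕ.s≤s ℕ.z≤n)))

    1≤ρ : 1# ≤ ρ
    1≤ρ = x≤x+y 1# 0≤ε/3

    3ρ≈3+ε : fromℕ 3 * ρ ≈ fromℕ 3 + ε
    3ρ≈3+ε = begin-equality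
      fromℕ 3 * (1# + ε * 3⁻¹)          ≈⟨ solve 3 (λ t e u → t :* (con 1 :+ e :* u) := t :+ e :* (t :* u))
              ≈-refl (fromℕ 3) ε 3⁻¹ ⟩
      fromℕ 3 + ε * (fromℕ 3 * 3⁻¹)     ≈⟨ +-congˡ (≈-trans (*-congˡ 3*3⁻¹≈1) (*-identityʳ ε)) ⟩
      fromℕ 3 + ε                       ∎

    3+ε≤4 : fromℕ 3 + ε ≤ fromℕ 4
    3+ε≤4 = ≤-trans (+-monoʳ-≤ (fromℕ 3) ε≤1) (≤-reflexive (+-comm (fromℕ 3) 1#))

    3ρ≤6 : fromℕ 3 * ρ ≤ fromℕ 6
    3ρ≤6 = begin
      fromℕ 3 * ρ  ≈⟨ 3ρ≈3+ε ⟩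
      fromℕ 3 + ε  ≤⟨ 3+ε≤4 ⟩
      fromℕ 4      ≤⟨ fromℕ-mono-≤ {4} {6} (ℕ.s≤s (ℕ.s≤s (ℕ.s≤s (ℕ.s≤s ℕ.z≤n)))) ⟩
      fromℕ 6      ∎

    2≤ρ^3q : fromℕ 2 ≤ ρ ^ (3 ℕ.* q)
    2≤ρ^3q = begin
      fromℕ 2                              ≈⟨ +-congˡ (+-identityʳ 1#) ⟩
      1# + 1#                              ≤⟨ +-monoʳ-≤ 1# 1≤qε ⟩
      1# + fromℕ q * ε                     ≈⟨ +-congˡ (*-identityʳ _) ⟨
      1# + fromℕ q * ε * 1#                ≈⟨ +-congˡ (*-congˡ 3*3⁻¹≈1) ⟨
      1# + fromℕ q * ε * (fromℕ 3 * 3⁻¹)   ≈⟨ +-congˡ (solve 4 (λ q e t u → q :* e :* (t :* u) := t :* q :* (e :* u))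
              ≈-refl (fromℕ q) ε (fromℕ 3) 3⁻¹) ⟩
      1# + fromℕ 3 * fromℕ q * (ε * 3⁻¹)   ≈⟨ +-congˡ (*-congʳ (fromℕ-* 3 q)) ⟨
      1# + fromℕ (3 ℕ.* q) * (ε * 3⁻¹)     ≤⟨ bernoulli 0≤ε/3 (3 ℕ.* q) ⟩
      ρ ^ (3 ℕ.* q)                        ∎

    p : ℕ
    p = 6 ℕ.* q

    -- A factor 2 takes at most `3 * q` guesses, and `3 + log k` doublings reach 8(k + 1), hence 6k.
    W₀ W : ℕ → ℕ
    W₀ k = 3 ℕ.* q ℕ.* (3 ℕ.+ log k)
    W  k = suc (W₀ k)

    6k≤R : ∀ k → fromℕ 6 * fromℕ k ≤ ρ ^ W k
    6k≤R k = begin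
      fromℕ 6 * fromℕ k                  ≈⟨ fromℕ-* 6 k ⟨
      fromℕ (6 ℕ.* k)                    ≤⟨ fromℕ-mono-≤ 6k≤2^ ⟩
      fromℕ (2 ℕ.^ (3 ℕ.+ log k))        ≤⟨ 2^≤^ 2≤ρ^3q (3 ℕ.+ log k) ⟩
      (ρ ^ (3 ℕ.* q)) ^ (3 ℕ.+ log k)    ≈⟨ ^-assocʳ ρ (3 ℕ.* q) (3 ℕ.+ log k) ⟩
      ρ ^ W₀ k                           ≈⟨ *-identityˡ _ ⟨
      1# * ρ ^ W₀ k                      ≤⟨ *-monoʳ-≤ (0≤^ (≤-trans 0≤1 1≤ρ) (W₀ k)) 1≤ρ ⟩
      ρ * ρ ^ W₀ k                       ∎
      where
      6k≤2^ : 6 ℕ.* k ℕ.≤ 2 ℕ.^ (3 ℕ.+ log k)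
      6k≤2^ = ℕ.≤-trans
        (ℕ.*-mono-≤ {6} {8} (ℕ.m≤m+n 6 2) (ℕ.≤-trans (ℕ.n≤1+n k) (n≤2^⌈log₂n⌉ (suc k))))
        (ℕ.≤-reflexive (sym (ℕ.^-distribˡ-+-* 2 3 (log k))))

    -- With p = 6q and 3τ ≤ v the averaging bound becomes (4q - 1) v ≤ 12 q a. Moreover 12 q ≤ (4q -
    -- 1)(3 + ε), because this amounts to 3 + ε ≤ 4 q ε, and 3 + ε ≤ 4 ≤ 4 q ε. This is why six sets
    -- per unit of `q` suffice.
    unfilled-ratio : ∀ {v τ a} → 0# ≤ a → fromℕ 3 * τ ≤ v → fromℕ p * v ≤ v + fromℕ p * (a + τ + a) →
                     v ≤ (fromℕ 3 + ε) * a
    unfilled-ratio {v} {τ} {a} 0≤a 3τ≤v average = *-cancelˡ-≤ 0<d (begin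
      d * v                      ≤⟨ +-cancelʳ-≤ (v + fromℕ 2 * Q * v) step₁ ⟩
      fromℕ 12 * Q * a           ≤⟨ *-monoʳ-≤ 0≤a 12Q≤ ⟩
      d * (fromℕ 3 + ε) * a      ≈⟨ *-assoc d _ a ⟩
      d * ((fromℕ 3 + ε) * a)    ∎)
      where
      q′ = ℕ.pred q
      Q = fromℕ q
      -- This is 4q - 1, written without subtraction to suit the semiring solver.
      d = fromℕ 3 + fromℕ 4 * fromℕ q′
      Q≈ : Q ≈ 1# + fromℕ q′
      Q≈ = ≈-reflexive (cong fromℕ (sym (ℕ.suc-pred q {{ℕ.>-nonZero 1≤q}})))
      d+1≈4Q : d + 1# ≈ fromℕ 4 * Q
      d+1≈4Q = ≈-trans (solve 1 (λ r → :ℕ 3 :+ :ℕ 4 :* r :+ con 1 := :ℕ 4 :* (con 1 :+ r))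
              ≈-refl (fromℕ q′)) (*-congˡ (≈-sym Q≈))
      0<d : 0# < d
      0<d = 1≤⇒0< (≤-trans (1≤fromℕ {3} (ℕ.s≤s ℕ.z≤n)) (x≤x+y (fromℕ 3) (*-nonNeg (0≤fromℕ 4) (0≤fromℕ q′))))
      0≤Q : 0# ≤ Q
      0≤Q = 0≤fromℕ q
      step₁ : d * v + (v + fromℕ 2 * Q * v) ≤ fromℕ 12 * Q * a + (v + fromℕ 2 * Q * v)
      step₁ = begin
        d * v + (v + fromℕ 2 * Q * v)
          ≈⟨ solve 3 (λ d v u → d :* v :+ (v :+ u) := (d :+ con 1) :* v :+ u) ≈-refl d v _ ⟩
        (d + 1#) * v + fromℕ 2 * Q * v
          ≈⟨ +-congʳ (*-congʳ d+1≈4Q) ⟩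
        fromℕ 4 * Q * v + fromℕ 2 * Q * v
          ≈⟨ solve 2 (λ q v → :ℕ 4 :* q :* v :+ :ℕ 2 :* q :* v := :ℕ 6 :* q :* v) ≈-refl Q v ⟩
        fromℕ 6 * Q * v
          ≈⟨ *-congʳ (fromℕ-* 6 q) ⟨
        fromℕ p * v
          ≤⟨ average ⟩
        v + fromℕ p * (a + τ + a)
          ≈⟨ +-congˡ (*-congʳ (fromℕ-* 6 q)) ⟩
        v + fromℕ 6 * Q * (a + τ + a)
          ≈⟨ solve 4 (λ v q a t → v :+ :ℕ 6 :* q :* (a :+ t :+ a) := :ℕ 12 :* q :* a :+ (v :+ :ℕ 2 :* q :* (:ℕ 3 :* t)))
                  ≈-refl v Q a τ ⟩
        fromℕ 12 * Q * a + (v + fromℕ 2 * Q * (fromℕ 3 * τ))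
          ≤⟨ +-monoʳ-≤ _ (+-monoʳ-≤ v (*-monoˡ-≤ (*-nonNeg (0≤fromℕ 2) 0≤Q) 3τ≤v)) ⟩
        fromℕ 12 * Q * a + (v + fromℕ 2 * Q * v)  ∎
      12Q≤ : fromℕ 12 * Q ≤ d * (fromℕ 3 + ε)
      12Q≤ = +-cancelʳ-≤ (fromℕ 3 + ε) (begin
        fromℕ 12 * Q + (fromℕ 3 + ε)              ≤⟨ +-monoʳ-≤ _ 3+ε≤4 ⟩
        fromℕ 12 * Q + fromℕ 4                    ≈⟨ +-congˡ (*-identityʳ (fromℕ 4)) ⟨
        fromℕ 12 * Q + fromℕ 4 * 1#               ≤⟨ +-monoʳ-≤ _ (*-monoˡ-≤ (0≤fromℕ 4) 1≤qε) ⟩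
        fromℕ 12 * Q + fromℕ 4 * (Q * ε)
          ≈⟨ solve 2 (λ q e → :ℕ 12 :* q :+ :ℕ 4 :* (q :* e) := :ℕ 4 :* q :* (:ℕ 3 :+ e))
              ≈-refl Q ε ⟩
        fromℕ 4 * Q * (fromℕ 3 + ε)               ≈⟨ *-congʳ d+1≈4Q ⟨
        (d + 1#) * (fromℕ 3 + ε)                  ≈⟨ solve 2 (λ d u → (d :+ con 1) :* u := d :* u :+ u)
                ≈-refl d (fromℕ 3 + ε) ⟩
        d * (fromℕ 3 + ε) + (fromℕ 3 + ε)         ∎)

    module Approximation (k : ℕ) (1≤k : 1 ℕ.≤ k) {n : ℕ} (f : Subset n → Carrier)
                         (nonNegative : NonNegative f) (submodular : Submodular f) where
      open Submodularity 𝔽 f nonNegative submodular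
      open Contents 𝔽
      open Sieve 𝔽 k (W k) p ρ using (B; R)
      open Correctness 𝔽 k (W k) p ρ f nonNegative submodular
      open Runs 𝔽 k (W k) p ρ f nonNegative submodular using (Outcome)

      module _ {A O : Subset n} (outcome : Outcome A) (optimal : IsOptimal f k O) where
        open Outcome outcome
        open Invariant invariant

        best-stored : ∀ T → (∀ {x} → x ∈ T → ∃[ y ] lookup σ y ≡ x) → ∣ T ∣ ℕ.≤ k → f T ≤ f A
        best-stored T T⊆σ ∣T∣≤k with m , eq , ∣m∣≤∣T∣ ← mask σ T T⊆σ =
          subst (λ U → f U ≤ f A) eq (proj₂ best m (ℕ.≤-trans ∣m∣≤∣T∣ ∣T∣≤k))

        contents-stored : ∀ m {x} → x ∈ contents σ m → ∃[ y ] lookup σ y ≡ x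
        contents-stored m x∈ with y , _ , eq ← ∈contents⁻ σ m x∈ = y , eq

        -- Covers guesses above the window: by `base-high` each element of OPT adds little even to
        -- `⊥`, and `⊥` is itself among the sets searched.
        optimum≤ : f O ≤ f A + base * R
        optimum≤ = *-cancelˡ-≤ (0<fromℕ 1≤k) (begin
          fromℕ k * f O                          ≡⟨ cong (λ S → fromℕ k * f S) (∪-identityˡ O) ⟨
          fromℕ k * f (⊥ ∪ O)
              ≤⟨ smallGains-∪ (0≤fromℕ k) 0≤baseR k O (proj₁ optimal) (λ {x} _ → singleton x) ⟩
          fromℕ k * f ⊥ + fromℕ k * (base * R)
              ≤⟨ +-monoˡ-≤ _ (*-monoˡ-≤ (0≤fromℕ k) (best-stored ⊥ (λ x∈ → contradiction x∈ ∉⊥)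
                                                      (ℕ.≤-trans (ℕ.≤-reflexive (∣⊥∣≡0 n)) ℕ.z≤n))) ⟩
          fromℕ k * f A + fromℕ k * (base * R)   ≈⟨ distribˡ _ _ _ ⟨
          fromℕ k * (f A + base * R)             ∎)
          where
          0≤baseR : 0# ≤ base * R
          0≤baseR = *-nonNeg base-nonNeg (0≤^ (≤-trans 0≤1 1≤ρ) (W k))
          singleton : ∀ x → SmallGain (fromℕ k) (base * R) ⊥ x
          singleton x = begin
            fromℕ k * f (⁅ x ⁆ ∪ ⊥)     ≡⟨ cong (λ S → fromℕ k * f S) (∪-identityʳ ⁅ x ⁆) ⟩
            fromℕ k * f ⁅ x ⁆           ≤⟨ base-high (all-seen x) ⟩
            base * R                    ≤⟨ x≤x+y _ (*-nonNeg (0≤fromℕ k) (nonNegative ⊥)) ⟩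
            base * R + fromℕ k * f ⊥    ≈⟨ +-comm _ _ ⟩
            fromℕ k * f ⊥ + base * R    ∎

        row-approximation : ∀ j → fromℕ 3 * (base * ρ ^ toℕ j) ≤ f O → f O ≤ fromℕ 3 * (base * ρ ^ suc (toℕ j)) →
                            f O ≤ (fromℕ 3 + ε) * f A
        row-approximation j low high with Fin.any? (λ i → k ℕ.≤? ∣ lookup (lookup M j) i ∣)
        ... | yes (i , full) = begin
          f O                                   ≤⟨ high ⟩
          fromℕ 3 * (base * (ρ * ρ ^ toℕ j))    ≈⟨ solve 4 (λ t b r e → t :* (b :* (r :* e)) := t :* r :* (b :* e))
                  ≈-refl (fromℕ 3) base ρ (ρ ^ toℕ j) ⟩
          fromℕ 3 * ρ * τ                       ≈⟨ *-congʳ 3ρ≈3+ε ⟩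
          (fromℕ 3 + ε) * τ
              ≤⟨ *-monoˡ-≤ (+-nonNeg (0≤fromℕ 3) 0≤ε) (≤-trans τ≤ (proj₂ best _ (size i))) ⟩
          (fromℕ 3 + ε) * f A                   ∎
          where
          open RowInvariant (rows j)
          τ = base * ρ ^ toℕ j
          0≤τ : 0# ≤ τ
          0≤τ = *-nonNeg base-nonNeg (0≤^ (≤-trans 0≤1 1≤ρ) (toℕ j))
          τ≤ : τ ≤ f (contents σ (lookup (lookup M j) i))
          τ≤ = *-cancelˡ-≤ (0<fromℕ 1≤k) (≤-trans (*-monoʳ-≤ 0≤τ (fromℕ-mono-≤ full)) (value i))
        ... | no unfilled = unfilled-ratio (nonNegative A) low
            (unfilled-row S O 1≤k 0≤τ (proj₁ optimal) disjoint
              (λ T T⊆ ∣T∣≤k → best-stored T (λ x∈ → contents-stored _ (proj₂ (∈⋃ᶠ⁻ S (T⊆ x∈)))) ∣T∣≤k)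
              (λ i → ℕ.≤-trans (∣contents∣≤ σ (lookup (lookup M j) i)) (size i)) small)
          where
          open RowInvariant (rows j)
          S : Fin p → Subset n
          S i = contents σ (lookup (lookup M j) i)
          0≤τ : 0# ≤ base * ρ ^ toℕ j
          0≤τ = *-nonNeg base-nonNeg (0≤^ (≤-trans 0≤1 1≤ρ) (toℕ j))
          small : ∀ i x → x ∉ ⋃ᶠ S → SmallGain (fromℕ k) (base * ρ ^ toℕ j) (S i) x
          small i x x∉ with handled i (all-seen x)
          ... | inj₁ (i′ , x∈)      = contradiction (∈⋃ᶠ⁺ S i′ x∈) x∉
          ... | inj₂ (inj₁ full)    = contradiction (i , full) unfilled
          ... | inj₂ (inj₂ small-x) = small-x

        approximation : f O ≤ (fromℕ 3 + ε) * f A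
        approximation with f O ≤? fromℕ 3 * (base * R)
        -- Here 3 `base * R` ≤ f(OPT), so 3 f(OPT) ≤ 3 f(A) + f(OPT), that is, 2 f(OPT) ≤ 3 f(A).
        ... | no far = begin
          f O                  ≤⟨ x≤x+y (f O) (nonNegative O) ⟩
          f O + f O            ≤⟨ +-cancelʳ-≤ (f O) (begin
            f O + f O + f O                       ≈⟨ solve 1 (λ o → o :+ o :+ o := :ℕ 3 :* o) ≈-refl (f O) ⟩
            fromℕ 3 * f O                         ≤⟨ *-monoˡ-≤ (0≤fromℕ 3) optimum≤ ⟩
            fromℕ 3 * (f A + base * R)            ≈⟨ distribˡ _ _ _ ⟩
            fromℕ 3 * f A + fromℕ 3 * (base * R)  ≤⟨ +-monoʳ-≤ _ (≰⇒≥ far) ⟩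
            fromℕ 3 * f A + f O                   ∎) ⟩
          fromℕ 3 * f A        ≤⟨ *-monoʳ-≤ (nonNegative A) (x≤x+y (fromℕ 3) 0≤ε) ⟩
          (fromℕ 3 + ε) * f A  ∎
        ... | yes near with j , j<W , low , high ← crossing (λ j → fromℕ 3 * (base * ρ ^ j)) (W₀ k)
                           (≤-trans (*-monoˡ-≤ (0≤fromℕ 3) (≤-reflexive (*-identityʳ base))) (base-low O optimal)) near =
          row-approximation (Fin.fromℕ< j<W)
            (subst (λ j → fromℕ 3 * (base * ρ ^ j) ≤ f O) (sym (Fin.toℕ-fromℕ< j<W)) low)
            (subst (λ j → f O ≤ fromℕ 3 * (base * ρ ^ suc j)) (sym (Fin.toℕ-fromℕ< j<W)) high)

    algorithm : StreamingAlgorithm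
    algorithm k = Sieve.machine 𝔽 k (W k) p ρ

    isApproximation : IsApproximation (fromℕ 3 + ε) algorithm
    isApproximation k 1≤k I = conclude (halts stream unique all)
      where
      open Instance I
      open Execution (algorithm k) f
      open Runs 𝔽 k (W k) p ρ f nonNegative submodular
      open Stream 1≤k 1≤ρ 3ρ≤6 (6k≤R k)
      open Approximation k 1≤k f nonNegative submodular

      unique : Unique stream
      unique = Permutation.Unique-resp-↭ (setoid (Fin n)) (↭⇒↭ₛ (↭-sym arrival)) (allFin⁺ n)

      all : ∀ x → x ∈ₗ stream
      all x = ∈-resp-↭ (↭-sym arrival) (∈-allFin x)

      0<3+ε : 0# < fromℕ 3 + ε
      0<3+ε = 1≤⇒0< (≤-trans (1≤fromℕ {3} (ℕ.s≤s ℕ.z≤n)) (x≤x+y (fromℕ 3) 0≤ε))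

      1≤3+ε : 1# ≤ fromℕ 3 + ε
      1≤3+ε = ≤-trans (1≤fromℕ {3} (ℕ.s≤s ℕ.z≤n)) (x≤x+y (fromℕ 3) 0≤ε)

      ratio : ∀ {A} → Final A → ∀ O → IsOptimal f k O → f O ≤ (fromℕ 3 + ε) * f A
      ratio (inj₁ (no-elements , refl)) O _ = begin
        f O                  ≡⟨ cong f (Empty-unique (λ (x , _) → no-elements x)) ⟩
        f ⊥                  ≈⟨ *-identityˡ _ ⟨
        1# * f ⊥             ≤⟨ *-monoʳ-≤ (nonNegative ⊥) 1≤3+ε ⟩
        (fromℕ 3 + ε) * f ⊥  ∎
      ratio (inj₂ outcome) O optimal = approximation outcome optimal

      feasible : ∀ {A} → Final A → ∣ A ∣ ℕ.≤ k
      feasible (inj₁ (_ , refl)) = ℕ.≤-trans (ℕ.≤-reflexive (∣⊥∣≡0 n)) ℕ.z≤n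
      feasible (inj₂ outcome)    = proj₁ (Outcome.best outcome)

      conclude : Halts Final (initial stream) →
                 ∃[ D ] (initial stream ⇓ D) × Always (λ S → ∣ S ∣ ℕ.≤ k) D
                      × (∀ OPT → IsOptimal f k OPT → f OPT * (fromℕ 3 + ε) ⁻¹ ≤ 𝔼 f D)
      conclude (A , ⇓A , final) =
        return A , ⇓A , return (feasible final) , λ O optimal → x≤z*y⇒x*z⁻¹≤y 0<3+ε (ratio final O optimal)

    -- 79 = 13 · 6 + 1: at most 13 q log k thresholds with 6 q sets each, and the spare slot.
    γ : ℕ
    γ = 79 ℕ.* (q ℕ.* q)

    G B : ℕ → ℕ
    G k = Sieve.G 𝔽 k (W k) p ρ
    B k = Sieve.B 𝔽 k (W k) p ρ

    G≤78 : ∀ {k} → 1 ℕ.≤ k → G k ℕ.≤ 78 ℕ.* (q ℕ.* q ℕ.* log k)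
    G≤78 {k} 1≤k = ℕ.≤-trans (ℕ.*-monoˡ-≤ p (W≤13ql 1≤q (1≤log 1≤k))) (ℕ.≤-reflexive (rearrange q (log k)))
      where
      rearrange : ∀ q l → 13 ℕ.* (q ℕ.* l) ℕ.* (6 ℕ.* q) ≡ 78 ℕ.* (q ℕ.* q ℕ.* l)
      rearrange = solve-∀

    1≤qql : ∀ {k} → 1 ℕ.≤ k → 1 ℕ.≤ q ℕ.* q ℕ.* log k
    1≤qql 1≤k = ℕ.*-mono-≤ (ℕ.*-mono-≤ 1≤q 1≤q) (1≤log 1≤k)

    1+G≤ : ∀ {k} → 1 ℕ.≤ k → suc (G k) ℕ.≤ γ ℕ.* log k
    1+G≤ {k} 1≤k = ℕ.≤-trans (ℕ.+-mono-≤ (1≤qql 1≤k) (G≤78 1≤k)) (ℕ.≤-reflexive (rearrange q (log k)))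
      where
      rearrange : ∀ q l → q ℕ.* q ℕ.* l ℕ.+ 78 ℕ.* (q ℕ.* q ℕ.* l) ≡ 79 ℕ.* (q ℕ.* q) ℕ.* l
      rearrange = solve-∀

    B≤ : ∀ {k} → 1 ℕ.≤ k → B k ℕ.≤ γ ℕ.* log k ℕ.* k
    B≤ {k} 1≤k = ℕ.≤-trans (ℕ.+-monoˡ-≤ (G k ℕ.* k) 1≤k) (ℕ.*-monoˡ-≤ k (1+G≤ 1≤k))

    isSemiStreaming : IsSemiStreaming algorithm
    isSemiStreaming = 21 ℕ.* (γ ℕ.* γ) ℕ.+ γ , 2 , bound
      where
      bound : ∀ k → 1 ℕ.≤ k → (I : Instance) →
              let open Instance I
                  open Execution (algorithm k) f
              in ∀ x → Reachable stream x →
                 memory x ℕ.≤ (21 ℕ.* (γ ℕ.* γ) ℕ.+ γ) ℕ.* (k ℕ.* (log k ℕ.+ log n) ℕ.^ 2)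
      bound k 1≤k I x _ = ℕ.≤-trans (Sieve.memory≤ 𝔽 k (W k) p ρ (Execution.Config.control x) l′)
        (memory-numeric γ (log k) l′ k (suc (G k)) (B k) (1+G≤ 1≤k) (B≤ 1≤k))
        where l′ = log (Instance.n I)

    -- 316 = 79 · 4, where the 4 comes from squaring q ≤ 2 ε⁻¹: one factor `q` is due to the number
    -- of guesses and one to the number of sets per guess.
    storesAtMost : fromℕ q ≤ fromℕ 2 * ε ⁻¹ →
                   StoresAtMost (λ k → fromℕ 316 * (fromℕ k * (ε ⁻¹ * ε ⁻¹) * fromℕ (log k))) algorithm
    storesAtMost q≤2ε⁻¹ k 1≤k I x _ = begin
      fromℕ (Sieve.elements 𝔽 k (W k) p ρ state)
          ≤⟨ fromℕ-mono-≤ (ℕ.≤-trans (Sieve.elements≤B 𝔽 k (W k) p ρ state) (B≤ 1≤k)) ⟩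
      fromℕ (γ ℕ.* log k ℕ.* k)                                    ≈⟨ expand ⟩
      fromℕ 79 * (Q * Q) * (L * K)
          ≤⟨ *-monoʳ-≤ (*-nonNeg (0≤fromℕ (log k)) (0≤fromℕ k)) (*-monoˡ-≤ (0≤fromℕ 79)
              (*-mono-≤ (0≤fromℕ q) (≤-trans (0≤fromℕ q) q≤2ε⁻¹) q≤2ε⁻¹ q≤2ε⁻¹)) ⟩
      fromℕ 79 * (fromℕ 2 * e * (fromℕ 2 * e)) * (L * K)
          ≈⟨ solve 5 (λ c d e l k → c :* (d :* e :* (d :* e)) :* (l :* k) := c :* (d :* d) :* (k :* (e :* e) :* l))
              ≈-refl (fromℕ 79) (fromℕ 2) e L K ⟩
      fromℕ 79 * (fromℕ 2 * fromℕ 2) * (K * (e * e) * L)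
          ≈⟨ *-congʳ (≈-trans (fromℕ-* 79 4) (*-congˡ (fromℕ-* 2 2))) ⟨
      fromℕ 316 * (K * (e * e) * L)                                ∎
      where
      state = Execution.Config.control x
      Q = fromℕ q
      L = fromℕ (log k)
      K = fromℕ k
      e = ε ⁻¹
      expand : fromℕ (γ ℕ.* log k ℕ.* k) ≈ fromℕ 79 * (Q * Q) * (L * K)
      expand = ≈-trans (fromℕ-* (γ ℕ.* log k) k) (≈-trans
        (*-congʳ (≈-trans (fromℕ-* γ (log k)) (*-congʳ (≈-trans (fromℕ-* 79 (q ℕ.* q)) (*-congˡ (fromℕ-* q q))))))
        (*-assoc _ L K))

theorem1p1 : ∀ {c ℓ₁ ℓ₂} (𝔽 : ArchimedeanField c ℓ₁ ℓ₂) →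
    let open ArchimedeanField 𝔽
        open Streaming 𝔽
    in ∃[ C ] ((ε : Carrier) → 0# < ε → ε ≤ 1# →
         Σ StreamingAlgorithm λ alg →
           IsApproximation (fromℕ 3 + ε) alg
           × IsSemiStreaming alg
           × StoresAtMost (λ k → fromℕ C * (fromℕ k * (ε ⁻¹ * ε ⁻¹) * fromℕ (log k))) alg)
theorem1p1 𝔽 = 316 , λ ε 0<ε ε≤1 →
  let q , 1≤q , 1≤qε , q≤2ε⁻¹ = Parameters.granularity 𝔽 0<ε ε≤1
      0≤ε = proj₁ 0<ε
  in Parameters.algorithm 𝔽 ε 0≤ε ε≤1 q 1≤q 1≤qε
   , Parameters.isApproximation 𝔽 ε 0≤ε ε≤1 q 1≤q 1≤qε
   , Parameters.isSemiStreaming 𝔽 ε 0≤ε ε≤1 q 1≤q 1≤qε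
   , Parameters.storesAtMost 𝔽 ε 0≤ε ε≤1 q 1≤q 1≤qε q≤2ε⁻¹
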